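{- For every integer $n\geq 0$, the polynomial $J_{2n}(x)$ is bi-$\gamma$-positive. Thus $J_{2n}(x)$ is alternatingly increasing and unimodal.
   Context: For $k\in(0,1)$ let $\mathrm{sn}(u,k)$ be the Jacobian elliptic function, i.e. $x=\mathrm{sn}(u,k)$ is the inverse of $u=\int_0^x\frac{dt}{\sqrt{(1-t^2)(1-k^2t^2)}}$, and let $\mathrm{cn}(u,k)=\sqrt{1-\mathrm{sn}^2(u,k)}$ (the branch near $u=0$ with $\mathrm{cn}(0,k)=1$). The polynomials $J_{2n}(x)$, $n\geq 1$, are defined by the Taylor expansion $\mathrm{cn}(u,k)=1+\sum_{n\geq 1}(-1)^nJ_{2n}(k^2)\frac{u^{2n}}{(2n)!}$, and $J_0(x)=1$. For $n\geq 1$ one has $\deg J_{2n}(x)=n-1$. For example $J_2(x)=1$, $J_4(x)=1+4x$, $J_6(x)=1+44x+16x^2$, $J_8(x)=1+408x+912x^2+64x^3$. A polynomial $f(x)=\sum_{i=0}^m f_ix^i$ of degree $m$ with real coefficients is unimodal if there is an index $r$ with $f_0\leq\cdots\leq f_r\geq f_{r+1}\geq\cdots\geq f_m$. It is alternatingly increasing if $f_0\leq f_m\leq f_1\leq f_{m-1}\leq\cdots\leq f_{\lfloor (m+1)/2\rfloor}$. A polynomial $h(x)$ satisfying $h(x)=x^d h(1/x)$ can be uniquely expanded as $h(x)=\sum_{k=0}^{\lfloor d/2\rfloor}\gamma_kx^k(1+x)^{d-2k}$, and it is called $\gamma$-positive if all $\gamma_k\geq 0$ (the zero polynomial is $\gamma$-positive).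 Every polynomial $f(x)$ of degree $m$ has a unique symmetric decomposition $(a(x),b(x))$, meaning $f(x)=a(x)+xb(x)$ with polynomials satisfying $a(x)=x^ma(1/x)$ and $b(x)=x^{m-1}b(1/x)$; explicitly $a(x)=\frac{f(x)-x^{m+1}f(1/x)}{1-x}$ and $b(x)=\frac{x^mf(1/x)-f(x)}{1-x}$. The polynomial $f(x)$ is bi-$\gamma$-positive if both $a(x)$ and $b(x)$ are $\gamma$-positive. -}

module Defs where

open import Algebra.Definitions.RawSemiring using ()
open import Data.Fin.Base using (toℕ)
open import Data.Integer.Base as ℤ using (ℤ; +_; -[1+_])
open import Data.List.Base using (List; []; _∷_; foldr)
open import Data.Nat.Base as ℕ using (ℕ; zero; suc; _∸_; ⌊_/2⌋; _!)
open import Data.Nat.Properties using (_!≢0)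
open import Data.Product.Base using (Σ-syntax; ∃-syntax; _×_)
open import Data.Rational.Base
  using (ℚ; 0ℚ; 1ℚ; _+_; _*_; _-_; -_; _/_; _≤_; _<_; +-*-rawSemiring)
open import Data.Vec.Functional using (Vector)
open import Relation.Binary.PropositionalEquality.Core using (_≡_; _≢_)

open Algebra.Definitions.RawSemiring +-*-rawSemiring public using (sum; _^_)

Series : Set
Series = ℕ → ℚ

infix  4 _≈ˢ_
infixl 6 _+ˢ_ _-ˢ_
infixl 7 _*ˢ_
infixr 8 _^ˢ_
infixr 9 _∘ˢ_

_≈ˢ_ : Series → Series → Set
f ≈ˢ g = ∀ n → f n ≡ g n

const : ℚ → Series
const q zero    = q
const q (suc _) = 0ℚ

X : Series
X zero          = 0ℚ
X (suc zero)    = 1ℚ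
X (suc (suc _)) = 0ℚ

_+ˢ_ _-ˢ_ _*ˢ_ : Series → Series → Series
(f +ˢ g) n = f n + g n
(f -ˢ g) n = f n - g n
(f *ˢ g) n = sum {suc n} (λ i → f (toℕ i) * g (n ∸ toℕ i))

_^ˢ_ : Series → ℕ → Series
f ^ˢ zero  = const 1ℚ
f ^ˢ suc n = f *ˢ f ^ˢ n

-- f(g(u)). Meaningful only for g 0 ≡ 0ℚ, when the powers of g beyond the
-- n-th do not contribute to the coefficient of u^n.
_∘ˢ_ : Series → Series → Series
(f ∘ˢ g) n = sum {suc n} (λ j → f (toℕ j) * (g ^ˢ toℕ j) n)

-- The antiderivative with constant term 0, i.e. ∫₀ˣ f(t) dt.
∫ : Series → Series
∫ f zero    = 0ℚ
∫ f (suc n) = (+ 1 / suc n) * f n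

-- The Jacobian elliptic functions of modulus k are represented by their Taylor
-- series at u = 0; square roots take the branch with value 1 at 0.

-- w(t) = 1 / √((1 - t²)(1 - k²t²))
IsIntegrand : ℚ → Series → Set
IsIntegrand k w =
  w 0 ≡ 1ℚ ×
  w ^ˢ 2 *ˢ ((const 1ℚ -ˢ X ^ˢ 2) *ˢ (const 1ℚ -ˢ const (k ^ 2) *ˢ X ^ˢ 2))
    ≈ˢ const 1ℚ

-- s is the compositional inverse of u = ∫₀ˣ w(t) dt.
IsSn : ℚ → Series → Set
IsSn k s = Σ[ w ∈ Series ] IsIntegrand k w × s 0 ≡ 0ℚ × ∫ w ∘ˢ s ≈ˢ X

-- c = √(1 - s²)
IsCn : ℚ → Series → Set
IsCn k c = Σ[ s ∈ Series ]
  IsSn k s × c 0 ≡ 1ℚ × c ^ˢ 2 ≈ˢ const 1ℚ -ˢ s ^ˢ 2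

-- Polynomials over ℚ, as lists of coefficients, constant term first.
-- Trailing zeros are allowed, so polynomials are compared through coeff.

Poly : Set
Poly = List ℚ

coeff : Poly → Series
coeff []      _       = 0ℚ
coeff (q ∷ p) zero    = q
coeff (q ∷ p) (suc i) = coeff p i

eval : Poly → ℚ → ℚ
eval p x = foldr (λ q r → q + x * r) 0ℚ p

HasDegree : Poly → ℕ → Set
HasDegree p m = coeff p m ≢ 0ℚ × (∀ i → m ℕ.< i → coeff p i ≡ 0ℚ)

-- The entry J n is the polynomial J_{2n}. It is determined by the values
-- at the infinitely many points k² with k rational, 0 < k < 1.
IsJacobiCnPolynomials : (ℕ → Poly) → Set
IsJacobiCnPolynomials J =
  coeff (J 0) ≈ˢ const 1ℚ ×
  (∀ k → 0ℚ < k → k < 1ℚ → Σ[ c ∈ Series ]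
    IsCn k c ×
    (∀ n → 1 ℕ.≤ n →
      c (2 ℕ.* n) ≡
        (- 1ℚ) ^ n * eval (J n) (k ^ 2) * (+ 1 / (2 ℕ.* n) !) {{(2 ℕ.* n) !≢0}}) ×
    (∀ n → c (suc (2 ℕ.* n)) ≡ 0ℚ))

coeffℤ : Poly → ℤ → ℚ
coeffℤ p (+ i)    = coeff p i
coeffℤ p -[1+ _ ] = 0ℚ

-- h(x) = x^d h(1/x), an identity of Laurent polynomials. The exponent is an
-- integer because the second part of the symmetric decomposition of a
-- nonzero constant has d = -1; for d < 0 only h = 0 is symmetric.
Symmetric : ℤ → Poly → Set
Symmetric d h = ∀ i → coeffℤ h i ≡ coeffℤ h (d ℤ.- i)

γ-expansion : (d : ℕ) → Vector ℚ (suc ⌊ d /2⌋) → Series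
γ-expansion d γ i =
  sum (λ k → γ k * (X ^ˢ toℕ k *ˢ (const 1ℚ +ˢ X) ^ˢ (d ∸ 2 ℕ.* toℕ k)) i)

HasNonnegativeγ : ℤ → Poly → Set
HasNonnegativeγ (+ d) h =
  Σ[ γ ∈ Vector ℚ (suc ⌊ d /2⌋) ]
    coeff h ≈ˢ γ-expansion d γ × (∀ k → 0ℚ ≤ γ k)
HasNonnegativeγ -[1+ _ ] h = coeff h ≈ˢ const 0ℚ

γ-Positive : ℤ → Poly → Set
γ-Positive d h = Symmetric d h × HasNonnegativeγ d h

IsSymmetricDecomposition : ℕ → Poly → Poly → Poly → Set
IsSymmetricDecomposition m f a b =
  coeff f ≈ˢ coeff a +ˢ X *ˢ coeff b ×
  Symmetric (+ m) a ×
  Symmetric (+ m ℤ.- + 1) b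

Bi-γ-Positive : Poly → Set
Bi-γ-Positive f = ∃[ m ] HasDegree f m ×
  (∃[ a ] ∃[ b ] IsSymmetricDecomposition m f a b ×
    γ-Positive (+ m) a × γ-Positive (+ m ℤ.- + 1) b)

Unimodal : Poly → Set
Unimodal f = ∃[ m ] HasDegree f m ×
  (∃[ r ] r ℕ.≤ m ×
    (∀ i → i ℕ.< r → coeff f i ≤ coeff f (suc i)) ×
    (∀ i → r ℕ.≤ i → i ℕ.< m → coeff f (suc i) ≤ coeff f i))

-- f₀ ≤ f_m ≤ f₁ ≤ f_{m-1} ≤ ⋯ ≤ f_{⌊(m+1)/2⌋} is a chain of m inequalities,
-- the (2i)-th being f_i ≤ f_{m-i} and the (2i+1)-st f_{m-i} ≤ f_{i+1}.
AlternatinglyIncreasing : Poly → Set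
AlternatinglyIncreasing f = ∃[ m ] HasDegree f m ×
  (∀ i → 2 ℕ.* i ℕ.< m → coeff f i ≤ coeff f (m ∸ i)) ×
  (∀ i → suc (2 ℕ.* i) ℕ.< m → coeff f (m ∸ i) ≤ coeff f (suc i))

{-# OPTIONS --safe #-}

-- Write x = k², τ = - (1 + x). Differentiating the defining relations gives
-- sn' = cn dn, cn' = - sn dn, dn' = - x sn cn, and the combinations
-- α = (dn - cn)/(1 - x), β = (dn - x cn)/(1 - x) satisfy
--   α' = β sn,  β' = x sn α,  sn' = τ β α + x α² + β²,  cn = β - α.
-- Up to sign, α and β = x b therefore carry the symmetric decomposition of the
-- J_{2n}, and the recurrences for the Taylor coefficients only multiply and add,
-- with nonnegative weights, polynomials in x and τ. Counting weight 4 for x and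
-- 2 for τ, the coefficients are homogeneous, so each one is
-- ± Σ γ_j x^j (1 + x)^(d - 2j) with all γ_j ≥ 0. The values at x = k² determine J_{2n}.

module Submission where

open import Defs
open import Algebra.Bundles using (CommutativeRing; CommutativeSemiring)
import Algebra.Solver.Ring.NaturalCoefficients.Default as Solver
open import Data.Fin.Base using (Fin; zero; suc; toℕ)
open import Data.Fin.Properties using (toℕ<n)
import Data.Integer.Base as ℤ
import Data.Integer.Properties as ℤₚ
open import Data.List.Base using ([]; _∷_; map)
open import Data.Nat.Base as ℕ using (ℕ; zero; suc; _∸_; z≤n; s≤s; ⌊_/2⌋; ⌈_/2⌉; _!)
open import Data.Nat.Induction using (<-rec)
import Data.Nat.Properties as ℕₚ
open import Data.Product.Base using (_×_; _,_; proj₁; proj₂; Σ-syntax; ∃-syntax)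
open import Data.Rational.Base
open import Data.Rational.Properties as ℚₚ hiding (<⇒≤)
import Data.Rational.Unnormalised.Base as ℚᵘ
import Data.Rational.Unnormalised.Properties as ℚᵘₚ
open import Data.Sum.Base using (_⊎_; inj₁; inj₂)
open import Data.Vec.Functional using (Vector)
open import Function.Base using (_∘_)
open import Level using (0ℓ)
open import Relation.Binary.PropositionalEquality
  using (_≡_; _≢_; refl; sym; trans; cong; cong₂; subst; subst₂; module ≡-Reasoning)
open import Relation.Nullary.Decidable.Core using (yes; no; dec⇒maybe)
open import Relation.Nullary.Negation.Core using (contradiction)
open import Tactic.RingSolver using (solve-∀)
open import Tactic.RingSolver.Core.AlmostCommutativeRing
  using (AlmostCommutativeRing; fromCommutativeRing)
open import Algebra.Properties.Semiring.Sum
  (CommutativeRing.semiring +-*-commutativeRing)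
  using (sum-cong-≗; ∑-distrib-+; *-distribˡ-sum)

-- The choice of α and β comes from dn(u,k) = cn(ku,1/k). For n ≥ 1 the Taylor coefficients of dn
-- are therefore, up to the factor (-1)^n/(2n)!, the reversed polynomials x^n J_{2n}(1/x). With m =
-- n - 1, the explicit formulas for a and x b become -(dn - cn)/(1 - x) and (dn - x cn)/(1 - x).
--
-- The hypothesis only supplies values, one k at a time. The recurrences are therefore run on
-- families of rationals indexed by k, and membership in a weight class asks for one list of
-- constants γ_j valid for all k at once. This uniformity is what allows a polynomial to be read off
-- at the end.
--
-- Nonnegative γ_j do not yet determine the degree of J_{2n}, on which all three conclusions depend.
-- So the coefficient of the pure power of τ in α is followed separately and kept strictly positive.
--
-- The inequalities come from two centres: a is symmetric about m/2 and x b about (m + 1)/2, and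
-- both rise up to their centre. Reflecting in one centre leaves one summand unchanged while the
-- other grows.

module SemiringIdentities {c ℓ} (R : CommutativeSemiring c ℓ) where
  open CommutativeSemiring R
    using (1#; setoid)
    renaming ( _+_ to _⊕_; _*_ to _⊗_; _≈_ to _≋_; refl to ≋-refl
             ; *-congˡ to ⊗-congˡ; *-congʳ to ⊗-congʳ; *-identityˡ to ⊗-identityˡ)
  open Solver R using (solve; _:=_; _:+_; _:*_)
  open import Relation.Binary.Reasoning.Setoid setoid

  -- The right side is the product of two compositions, each unfolded as head plus g times the
  -- composed tail; the left side is the unfolding of the composed product.
  ⊗-expand : ∀ a b g x y → a ⊗ b ⊕ g ⊗ (a ⊗ x ⊕ y ⊗ (b ⊕ g ⊗ x)) ≋ (a ⊕ g ⊗ y) ⊗ (b ⊕ g ⊗ x)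
  ⊗-expand = solve 5 (λ a b g x y →
    a :* b :+ g :* (a :* x :+ y :* (b :+ g :* x)) := (a :+ g :* y) :* (b :+ g :* x)) ≋-refl

  ⊗-collect : ∀ a g x y → a ⊗ x ⊕ g ⊗ (y ⊗ a) ≋ (x ⊕ g ⊗ y) ⊗ a
  ⊗-collect = solve 4 (λ a g x y → a :* x :+ g :* (y :* a) := (x :+ g :* y) :* a) ≋-refl

  -- With w = 1/√(pq) and c = √p, the product w c q is a square root of q. In the application p = 1
  -- - sn² and q = 1 - x sn², so this is dn.
  ^2-inverse : ∀ {w c p q} → (w ⊗ w) ⊗ (p ⊗ q) ≋ 1# → c ⊗ c ≋ p → (w ⊗ c ⊗ q) ⊗ (w ⊗ c ⊗ q) ≋ q
  ^2-inverse {w} {c} {p} {q} wwpq≋1 cc≋p = begin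
    (w ⊗ c ⊗ q) ⊗ (w ⊗ c ⊗ q)
      ≈⟨ solve 3 (λ w c q → (w :* c :* q) :* (w :* c :* q) := (w :* w) :* ((c :* c) :* q) :* q) ≋-refl w c q ⟩
    (w ⊗ w) ⊗ ((c ⊗ c) ⊗ q) ⊗ q ≈⟨ ⊗-congʳ (⊗-congˡ (⊗-congʳ cc≋p)) ⟩
    (w ⊗ w) ⊗ (p ⊗ q) ⊗ q       ≈⟨ ⊗-congʳ wwpq≋1 ⟩
    1# ⊗ q                      ≈⟨ ⊗-identityˡ q ⟩
    q                           ∎

  inverse-unique : ∀ {w t c p q} → (w ⊗ w) ⊗ (p ⊗ q) ≋ 1# → w ⊗ t ≋ 1# → c ⊗ c ≋ p → c ⊗ (w ⊗ c ⊗ q) ≋ t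
  inverse-unique {w} {t} {c} {p} {q} wwpq≋1 wt≋1 cc≋p = begin
    c ⊗ (w ⊗ c ⊗ q)
      ≈⟨ solve 3 (λ w c q → c :* (w :* c :* q) := w :* ((c :* c) :* q)) ≋-refl w c q ⟩
    w ⊗ ((c ⊗ c) ⊗ q)         ≈⟨ ⊗-congˡ (⊗-congʳ cc≋p) ⟩
    w ⊗ (p ⊗ q)               ≈⟨ ⊗-identityˡ _ ⟨
    1# ⊗ (w ⊗ (p ⊗ q))        ≈⟨ ⊗-congʳ wt≋1 ⟨
    (w ⊗ t) ⊗ (w ⊗ (p ⊗ q))
      ≈⟨ solve 4 (λ w t p q → (w :* t) :* (w :* (p :* q)) := (w :* w) :* (p :* q) :* t) ≋-refl w t p q ⟩
    (w ⊗ w) ⊗ (p ⊗ q) ⊗ t     ≈⟨ ⊗-congʳ wwpq≋1 ⟩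
    1# ⊗ t                    ≈⟨ ⊗-identityˡ t ⟩
    t                         ∎

  -- As t is a unit and t = u v, the factor u is a unit too and may be cancelled. With u = cn, v =
  -- dn, t = sn' it turns cn cn' = - sn sn' into cn' = - sn dn, and the same with cn and dn
  -- exchanged.
  cancel-unit : ∀ {w t u v u′ n} → w ⊗ t ≋ 1# → u ⊗ v ≋ t → u ⊗ u′ ≋ n ⊗ t → u′ ≋ n ⊗ v
  cancel-unit {w} {t} {u} {v} {u′} {n} wt≋1 uv≋t uu′≋nt = begin
    u′                    ≈⟨ ⊗-identityˡ u′ ⟨
    1# ⊗ u′               ≈⟨ ⊗-congʳ wt≋1 ⟨
    (w ⊗ t) ⊗ u′          ≈⟨ ⊗-congʳ (⊗-congˡ uv≋t) ⟨
    (w ⊗ (u ⊗ v)) ⊗ u′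
      ≈⟨ solve 4 (λ w u v u′ → (w :* (u :* v)) :* u′ := (w :* v) :* (u :* u′)) ≋-refl w u v u′ ⟩
    (w ⊗ v) ⊗ (u ⊗ u′)    ≈⟨ ⊗-congˡ uu′≋nt ⟩
    (w ⊗ v) ⊗ (n ⊗ t)
      ≈⟨ solve 4 (λ w v n t → (w :* v) :* (n :* t) := (w :* t) :* (n :* v)) ≋-refl w v n t ⟩
    (w ⊗ t) ⊗ (n ⊗ v)     ≈⟨ ⊗-congʳ wt≋1 ⟩
    1# ⊗ (n ⊗ v)          ≈⟨ ⊗-identityˡ _ ⟩
    n ⊗ v                 ∎

ℚ-ring : AlmostCommutativeRing 0ℓ 0ℓ
ℚ-ring = fromCommutativeRing +-*-commutativeRing (λ q → dec⇒maybe (0ℚ ≟ q))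

-- The ring of power series

infix 8 -ˢ_

-ˢ_ : Series → Series
(-ˢ f) n = - f n

0ˢ 1ˢ : Series
0ˢ _ = 0ℚ
1ˢ   = const 1ℚ

tail : Series → Series
tail f n = f (suc n)

scale : ℚ → Series → Series
scale q f n = q * f n

≈ˢ-refl : ∀ {f} → f ≈ˢ f
≈ˢ-refl _ = refl

≈ˢ-sym : ∀ {f g} → f ≈ˢ g → g ≈ˢ f
≈ˢ-sym e n = sym (e n)

≈ˢ-trans : ∀ {f g h} → f ≈ˢ g → g ≈ˢ h → f ≈ˢ h
≈ˢ-trans e e′ n = trans (e n) (e′ n)

*ˢ-cong≤ : ∀ {f f′ g g′} n → (∀ i → i ℕ.≤ n → f i ≡ f′ i) → (∀ i → i ℕ.≤ n → g i ≡ g′ i) →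
           (f *ˢ g) n ≡ (f′ *ˢ g′) n
*ˢ-cong≤ n ef eg = sum-cong-≗ {suc n} λ i →
  cong₂ _*_ (ef (toℕ i) (ℕₚ.≤-pred (toℕ<n i))) (eg (n ∸ toℕ i) (ℕₚ.m∸n≤m n (toℕ i)))

*ˢ-cong : ∀ {f f′ g g′} → f ≈ˢ f′ → g ≈ˢ g′ → f *ˢ g ≈ˢ f′ *ˢ g′
*ˢ-cong ef eg n = *ˢ-cong≤ n (λ i _ → ef i) (λ i _ → eg i)

*ˢ-zeroˡ : ∀ f → 0ˢ *ˢ f ≈ˢ 0ˢ
*ˢ-zeroˡ f zero    = trans (+-identityʳ (0ℚ * f 0)) (*-zeroˡ (f 0))
*ˢ-zeroˡ f (suc n) = trans (cong₂ _+_ (*-zeroˡ (f (suc n))) (*ˢ-zeroˡ f n)) refl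

*ˢ-distribʳ : ∀ h f g → (f +ˢ g) *ˢ h ≈ˢ f *ˢ h +ˢ g *ˢ h
*ˢ-distribʳ h f g zero    = lemma (h 0) (f 0) (g 0)
  where
  lemma : ∀ h f g → (f + g) * h + 0ℚ ≡ (f * h + 0ℚ) + (g * h + 0ℚ)
  lemma = solve-∀ ℚ-ring
*ˢ-distribʳ h f g (suc n) = trans
  (cong ((f 0 + g 0) * h (suc n) +_) (*ˢ-distribʳ h (tail f) (tail g) n))
  (lemma (h (suc n)) (f 0) (g 0) _ _)
  where
  lemma : ∀ h f g a b → (f + g) * h + (a + b) ≡ (f * h + a) + (g * h + b)
  lemma = solve-∀ ℚ-ring

scale-*ˢ : ∀ q f g → scale q f *ˢ g ≈ˢ scale q (f *ˢ g)
scale-*ˢ q f g zero    = lemma q (f 0) (g 0)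
  where
  lemma : ∀ q f g → q * f * g + 0ℚ ≡ q * (f * g + 0ℚ)
  lemma = solve-∀ ℚ-ring
scale-*ˢ q f g (suc n) = trans
  (cong (q * f 0 * g (suc n) +_) (scale-*ˢ q (tail f) g n))
  (lemma q (f 0) (g (suc n)) _)
  where
  lemma : ∀ q f g a → q * f * g + q * a ≡ q * (f * g + a)
  lemma = solve-∀ ℚ-ring

-- The convolution unfolds by taking off the head of the first factor. Commutativity by induction
-- also needs the expansion that shortens the second one.
*ˢ-sucʳ : ∀ f g n → (f *ˢ g) (suc n) ≡ (f *ˢ tail g) n + f (suc n) * g 0
*ˢ-sucʳ f g zero    = lemma (f 0) (f 1) (g 0) (g 1)
  where
  lemma : ∀ f₀ f₁ g₀ g₁ → f₀ * g₁ + (f₁ * g₀ + 0ℚ) ≡ (f₀ * g₁ + 0ℚ) + f₁ * g₀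
  lemma = solve-∀ ℚ-ring
*ˢ-sucʳ f g (suc n) = trans
  (cong (f 0 * g (suc (suc n)) +_) (*ˢ-sucʳ (tail f) g n))
  (sym (+-assoc (f 0 * g (suc (suc n))) _ _))

*ˢ-comm : ∀ f g → f *ˢ g ≈ˢ g *ˢ f
*ˢ-comm f g zero    = cong (_+ 0ℚ) (*-comm (f 0) (g 0))
*ˢ-comm f g (suc n) = trans
  (cong₂ _+_ (*-comm (f 0) (g (suc n))) (*ˢ-comm (tail f) g n))
  (trans (+-comm (g (suc n) * f 0) _) (sym (*ˢ-sucʳ g f n)))

*ˢ-assoc : ∀ f g h → (f *ˢ g) *ˢ h ≈ˢ f *ˢ (g *ˢ h)
*ˢ-assoc f g h zero    = lemma (f 0) (g 0) (h 0)
  where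
  lemma : ∀ f g h → (f * g + 0ℚ) * h + 0ℚ ≡ f * (g * h + 0ℚ) + 0ℚ
  lemma = solve-∀ ℚ-ring
*ˢ-assoc f g h (suc n) = begin
  (f 0 * g 0 + 0ℚ) * h (suc n) + ((scale (f 0) (tail g) +ˢ tail f *ˢ g) *ˢ h) n
    ≡⟨ cong ((f 0 * g 0 + 0ℚ) * h (suc n) +_)
         (*ˢ-distribʳ h (scale (f 0) (tail g)) (tail f *ˢ g) n) ⟩
  (f 0 * g 0 + 0ℚ) * h (suc n) + ((scale (f 0) (tail g) *ˢ h) n + ((tail f *ˢ g) *ˢ h) n)
    ≡⟨ cong₂ (λ a b → (f 0 * g 0 + 0ℚ) * h (suc n) + (a + b))
         (scale-*ˢ (f 0) (tail g) h n) (*ˢ-assoc (tail f) g h n) ⟩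
  (f 0 * g 0 + 0ℚ) * h (suc n) + (f 0 * (tail g *ˢ h) n + (tail f *ˢ (g *ˢ h)) n)
    ≡⟨ lemma (f 0) (g 0) (h (suc n)) _ _ ⟩
  f 0 * (g 0 * h (suc n) + (tail g *ˢ h) n) + (tail f *ˢ (g *ˢ h)) n ∎
  where
  open ≡-Reasoning
  lemma : ∀ f g h a b → (f * g + 0ℚ) * h + (f * a + b) ≡ f * (g * h + a) + b
  lemma = solve-∀ ℚ-ring

const-*ˢ : ∀ q f → const q *ˢ f ≈ˢ scale q f
const-*ˢ q f zero    = +-identityʳ (q * f 0)
const-*ˢ q f (suc n) = trans (cong (q * f (suc n) +_) (*ˢ-zeroˡ f n)) (+-identityʳ _)

*ˢ-identityˡ : ∀ f → 1ˢ *ˢ f ≈ˢ f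
*ˢ-identityˡ f n = trans (const-*ˢ 1ℚ f n) (*-identityˡ (f n))

tail-X : tail X ≈ˢ 1ˢ
tail-X zero    = refl
tail-X (suc n) = refl

X-*ˢ : ∀ f n → (X *ˢ f) (suc n) ≡ f n
X-*ˢ f n = trans
  (cong₂ _+_ (*-zeroˡ (f (suc n)))
    (trans (*ˢ-cong tail-X (≈ˢ-refl {f}) n) (*ˢ-identityˡ f n)))
  (+-identityˡ (f n))

X-*ˢ-zero : ∀ f → (X *ˢ f) 0 ≡ 0ℚ
X-*ˢ-zero f = trans (+-identityʳ (0ℚ * f 0)) (*-zeroˡ (f 0))

seriesRing : CommutativeRing 0ℓ 0ℓ
seriesRing = record
  { Carrier = Series ; _≈_ = _≈ˢ_ ; _+_ = _+ˢ_ ; _*_ = _*ˢ_ ; -_ = -ˢ_ ; 0# = 0ˢ ; 1# = 1ˢ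
  ; isCommutativeRing = record
    { isRing = record
      { +-isAbelianGroup = record
        { isGroup = record
          { isMonoid = record
            { isSemigroup = record
              { isMagma = record
                { isEquivalence = record
                  { refl  = λ {f} → ≈ˢ-refl {f}
                  ; sym   = λ {f} {g} → ≈ˢ-sym {f} {g}
                  ; trans = λ {f} {g} {h} → ≈ˢ-trans {f} {g} {h}
                  }
                ; ∙-cong = λ e e′ n → cong₂ _+_ (e n) (e′ n)
                }
              ; assoc = λ f g h n → +-assoc (f n) (g n) (h n)
              }
            ; identity = (λ f n → +-identityˡ (f n)) , (λ f n → +-identityʳ (f n))
            }
          ; inverse = (λ f n → +-inverseˡ (f n)) , (λ f n → +-inverseʳ (f n))
          ; ⁻¹-cong = λ e n → cong -_ (e n)
          }
        ; comm = λ f g n → +-comm (f n) (g n)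
        }
      ; *-cong = λ {f} {f′} {g} {g′} → *ˢ-cong {f} {f′} {g} {g′}
      ; *-assoc = *ˢ-assoc
      ; *-identity = *ˢ-identityˡ , λ f → ≈ˢ-trans {f *ˢ 1ˢ} {1ˢ *ˢ f} {f} (*ˢ-comm f 1ˢ) (*ˢ-identityˡ f)
      ; distrib = (λ f g h n → trans (*ˢ-comm f (g +ˢ h) n) (trans (*ˢ-distribʳ f g h n)
                      (cong₂ _+_ (*ˢ-comm g f n) (*ˢ-comm h f n))))
                , *ˢ-distribʳ
      }
    ; *-comm = *ˢ-comm
    }
  }

module S = CommutativeRing seriesRing

-- Derivatives

-- Unfolding to `1ℚ + nat n` exposes the split n + 2 = 1 + (n + 1) on which the induction for the
-- Leibniz rule rests.
nat : ℕ → ℚ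
nat zero    = 0ℚ
nat (suc n) = 1ℚ + nat n

D : Series → Series
D f n = nat (suc n) * f (suc n)

D-cong : ∀ {f g} → f ≈ˢ g → D f ≈ˢ D g
D-cong e n = cong (nat (suc n) *_) (e (suc n))

D-+ˢ : ∀ f g → D (f +ˢ g) ≈ˢ D f +ˢ D g
D-+ˢ f g n = *-distribˡ-+ (nat (suc n)) (f (suc n)) (g (suc n))

D-const : ∀ q → D (const q) ≈ˢ 0ˢ
D-const q n = *-zeroʳ (nat (suc n))

tail-D : ∀ f → tail (D f) ≈ˢ tail (tail f) +ˢ D (tail f)
tail-D f n = lemma (nat (suc n)) (f (suc (suc n)))
  where
  lemma : ∀ k a → (1ℚ + k) * a ≡ a + k * a
  lemma = solve-∀ ℚ-ring

D-*ˢ : ∀ f g → D (f *ˢ g) ≈ˢ D f *ˢ g +ˢ f *ˢ D g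
D-*ˢ f g zero    = lemma (f 0) (f 1) (g 0) (g 1)
  where
  lemma : ∀ f₀ f₁ g₀ g₁ → (1ℚ + 0ℚ) * (f₀ * g₁ + (f₁ * g₀ + 0ℚ)) ≡
                          (1ℚ + 0ℚ) * f₁ * g₀ + 0ℚ + (f₀ * ((1ℚ + 0ℚ) * g₁) + 0ℚ)
  lemma = solve-∀ ℚ-ring
D-*ˢ f g (suc n) = begin
  nat (suc (suc n)) * (f 0 * g₂ + h)
    ≡⟨ lemma₁ (nat (suc n)) (f 0 * g₂) h ⟩
  (h + nat (suc (suc n)) * (f 0 * g₂)) + nat (suc n) * h
    ≡⟨ cong ((h + nat (suc (suc n)) * (f 0 * g₂)) +_) (D-*ˢ (tail f) g n) ⟩
  (f 1 * g (suc n) + (tail (tail f) *ˢ g) n + nat (suc (suc n)) * (f 0 * g₂))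
    + ((D (tail f) *ˢ g) n + (tail f *ˢ D g) n)
    ≡⟨ lemma₂ (f 0) (f 1) (g (suc n)) g₂ (nat (suc (suc n))) _ _ _ ⟩
  (1ℚ + 0ℚ) * f 1 * g (suc n) + ((tail (tail f) *ˢ g) n + (D (tail f) *ˢ g) n)
    + (f 0 * (nat (suc (suc n)) * g₂) + (tail f *ˢ D g) n)
    ≡⟨ cong (λ a → (1ℚ + 0ℚ) * f 1 * g (suc n) + a + (f 0 * D g (suc n) + (tail f *ˢ D g) n))
         (trans (sym (*ˢ-distribʳ g (tail (tail f)) (D (tail f)) n))
                (*ˢ-cong (≈ˢ-sym {tail (D f)} (tail-D f)) (≈ˢ-refl {g}) n)) ⟩
  (D f *ˢ g +ˢ f *ˢ D g) (suc n) ∎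
  where
  open ≡-Reasoning
  g₂ = g (suc (suc n))
  h  = (tail f *ˢ g) (suc n)
  lemma₁ : ∀ k a h → (1ℚ + k) * (a + h) ≡ (h + (1ℚ + k) * a) + k * h
  lemma₁ = solve-∀ ℚ-ring
  lemma₂ : ∀ f₀ f₁ g₁ g₂ k a b c →
    (f₁ * g₁ + a + k * (f₀ * g₂)) + (b + c) ≡
    (1ℚ + 0ℚ) * f₁ * g₁ + (a + b) + (f₀ * (k * g₂) + c)
  lemma₂ = solve-∀ ℚ-ring

nat≡/1 : ∀ n → toℚᵘ (nat n) ℚᵘ.≃ ℚᵘ.mkℚᵘ (ℤ.+ n) 0
nat≡/1 zero    = ℚᵘ.*≡* refl
nat≡/1 (suc n) = ℚᵘₚ.≃-trans (toℚᵘ-homo-+ 1ℚ (nat n))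
  (ℚᵘₚ.≃-trans (ℚᵘₚ.+-congʳ ℚᵘ.1ℚᵘ (nat≡/1 n))
    (ℚᵘ.*≡* (cong (λ i → (ℤ.+ 1 ℤ.+ i) ℤ.* ℤ.+ 1) (ℤₚ.*-identityʳ (ℤ.+ n)))))

1/-nat : ∀ n → (ℤ.+ 1 / suc n) * nat (suc n) ≡ 1ℚ
1/-nat n = toℚᵘ-injective (ℚᵘₚ.≃-trans (toℚᵘ-homo-* (ℤ.+ 1 / suc n) (nat (suc n)))
  (ℚᵘₚ.≃-trans (ℚᵘₚ.*-cong (toℚᵘ-fromℚᵘ (ℚᵘ.mkℚᵘ (ℤ.+ 1) n)) (nat≡/1 (suc n)))
    (ℚᵘ.*≡* (trans (ℤₚ.*-identityʳ (ℤ.1ℤ ℤ.* ℤ.+ suc n)) (trans (ℤₚ.*-identityˡ (ℤ.+ suc n))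
      (sym (trans (ℤₚ.*-identityˡ _) (cong ℤ.+_ (ℕₚ.*-identityʳ (suc n))))))))))

D-∫ : ∀ f → D (∫ f) ≈ˢ f
D-∫ f n = begin
  nat (suc n) * ((ℤ.+ 1 / suc n) * f n) ≡⟨ lemma (nat (suc n)) (ℤ.+ 1 / suc n) (f n) ⟩
  (ℤ.+ 1 / suc n) * nat (suc n) * f n   ≡⟨ cong (_* f n) (1/-nat n) ⟩
  1ℚ * f n                            ≡⟨ *-identityˡ (f n) ⟩
  f n                                 ∎
  where
  open ≡-Reasoning
  lemma : ∀ a b c → a * (b * c) ≡ b * a * c
  lemma = solve-∀ ℚ-ring

open SemiringIdentities S.commutativeSemiring

-- Composition

*ˢ-scale : ∀ q f g → f *ˢ scale q g ≈ˢ scale q (f *ˢ g)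
*ˢ-scale q f g n = trans (*ˢ-comm f (scale q g) n)
  (trans (scale-*ˢ q g f n) (cong (q *_) (*ˢ-comm g f n)))

*ˢ-sum : ∀ {N} g (t : Fin N → Series) n →
         (g *ˢ (λ m → sum (λ j → t j m))) n ≡ sum (λ j → (g *ˢ t j) n)
*ˢ-sum {zero}  g t n = S.zeroʳ g n
*ˢ-sum {suc N} g t n = trans
  (S.distribˡ g (t zero) (λ m → sum (λ j → t (suc j) m)) n)
  (cong ((g *ˢ t zero) n +_) (*ˢ-sum g (t ∘ suc) n))

-- Without a constant term in g, coefficient n of the product does not see `h n`. This gain of one
-- degree drives every strong induction about composition.
*ˢ-cong< : ∀ {g h h′} n → g 0 ≡ 0ℚ → (∀ i → i ℕ.< n → h i ≡ h′ i) → (g *ˢ h) n ≡ (g *ˢ h′) n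
*ˢ-cong< {g} {h} {h′} zero g₀ e = cong (_+ 0ℚ) (trans (vanish (h 0)) (sym (vanish (h′ 0))))
  where
  vanish : ∀ a → g 0 * a ≡ 0ℚ
  vanish a = trans (cong (_* a) g₀) (*-zeroˡ a)
*ˢ-cong< {g} {h} {h′} (suc n) g₀ e = cong₂ _+_
  (trans (vanish (h (suc n))) (sym (vanish (h′ (suc n)))))
  (*ˢ-cong≤ {tail g} n (λ _ _ → refl) (λ i i≤n → e i (s≤s i≤n)))
  where
  vanish : ∀ a → g 0 * a ≡ 0ℚ
  vanish a = trans (cong (_* a) g₀) (*-zeroˡ a)

const≈scale : ∀ q → const q ≈ˢ scale q 1ˢ
const≈scale q zero    = sym (*-identityʳ q)
const≈scale q (suc n) = sym (*-zeroʳ q)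

-- In `_∘ˢ_` the number of summands is tied to the coefficient index. Here the two are independent,
-- so that the Horner recursion on the tail of f can be stated.
compose : ℕ → Series → Series → Series
compose N f g n = sum {N} (λ j → f (toℕ j) * (g ^ˢ toℕ j) n)

compose-suc : ∀ N f g → compose (suc N) f g ≈ˢ const (f 0) +ˢ g *ˢ compose N (tail f) g
compose-suc N f g n = cong₂ _+_ (sym (const≈scale (f 0) n))
  (trans
    (sum-cong-≗ {N} (λ j → sym (*ˢ-scale (f (suc (toℕ j))) g (g ^ˢ toℕ j) n)))
    (sym (*ˢ-sum {N} g (λ j → scale (f (suc (toℕ j))) (g ^ˢ toℕ j)) n)))

-- Each Horner step puts a factor g in front and so lowers the index that matters; `b` is a bound on
-- that index and serves only as the recursion measure.
compose-stable : ∀ {g} → g 0 ≡ 0ℚ → ∀ b n → n ℕ.< b → ∀ M N f → n ℕ.< M → n ℕ.< N →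
                 compose M f g n ≡ compose N f g n
compose-stable {g} g₀ (suc b) n n<b (suc M) (suc N) f n<M n<N = trans
  (compose-suc M f g n)
  (trans
    (cong (const (f 0) n +_) (*ˢ-cong< {g} n g₀ (λ i i<n →
      compose-stable g₀ b i (ℕₚ.<-≤-trans i<n (ℕₚ.≤-pred n<b)) M N (tail f)
        (ℕₚ.<-≤-trans i<n (ℕₚ.≤-pred n<M)) (ℕₚ.<-≤-trans i<n (ℕₚ.≤-pred n<N)))))
    (sym (compose-suc N f g n)))

module Composition (g : Series) (g₀ : g 0 ≡ 0ℚ) where

  ∘ˢ-unfold : ∀ f → f ∘ˢ g ≈ˢ const (f 0) +ˢ g *ˢ (tail f ∘ˢ g)
  ∘ˢ-unfold f n = trans (compose-suc n f g n)
    (cong (const (f 0) n +_) (*ˢ-cong< {g} n g₀ λ i i<n →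
      compose-stable g₀ (suc i) i ℕₚ.≤-refl n (suc i) (tail f) i<n ℕₚ.≤-refl))

  ∘ˢ-congˡ : ∀ {f f′} → f ≈ˢ f′ → f ∘ˢ g ≈ˢ f′ ∘ˢ g
  ∘ˢ-congˡ e n = sum-cong-≗ {suc n} λ j → cong (_* (g ^ˢ toℕ j) n) (e (toℕ j))

  ∘ˢ-+ˢ : ∀ f h → (f +ˢ h) ∘ˢ g ≈ˢ f ∘ˢ g +ˢ h ∘ˢ g
  ∘ˢ-+ˢ f h n = trans
    (sum-cong-≗ {suc n} λ j → *-distribʳ-+ ((g ^ˢ toℕ j) n) (f (toℕ j)) (h (toℕ j)))
    (∑-distrib-+ {suc n} (λ j → f (toℕ j) * (g ^ˢ toℕ j) n) (λ j → h (toℕ j) * (g ^ˢ toℕ j) n))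

  ∘ˢ-scale : ∀ q f → scale q f ∘ˢ g ≈ˢ scale q (f ∘ˢ g)
  ∘ˢ-scale q f n = trans
    (sum-cong-≗ {suc n} λ j → *-assoc q (f (toℕ j)) ((g ^ˢ toℕ j) n))
    (sym (*-distribˡ-sum {suc n} q (λ j → f (toℕ j) * (g ^ˢ toℕ j) n)))

  ∘ˢ-const : ∀ q → const q ∘ˢ g ≈ˢ const q
  ∘ˢ-const q n = trans (∘ˢ-unfold (const q) n)
    (trans (cong (const q n +_) (trans (S.*-congˡ {g} zero-∘ˢ n) (S.zeroʳ g n))) (+-identityʳ _))
    where
    zero-∘ˢ : 0ˢ ∘ˢ g ≈ˢ 0ˢ
    zero-∘ˢ n = trans (∘ˢ-congˡ {0ˢ} {scale 0ℚ 0ˢ} (λ m → sym (*-zeroˡ 0ℚ)) n)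
      (trans (∘ˢ-scale 0ℚ 0ˢ n) (*-zeroˡ ((0ˢ ∘ˢ g) n)))

  ∘ˢ-X*ˢ : ∀ f → (X *ˢ f) ∘ˢ g ≈ˢ g *ˢ (f ∘ˢ g)
  ∘ˢ-X*ˢ f n = trans (∘ˢ-unfold (X *ˢ f) n)
    (trans (cong₂ _+_ (vanish n) (S.*-congˡ {g} (∘ˢ-congˡ (X-*ˢ f)) n))
      (+-identityˡ _))
    where
    vanish : const ((X *ˢ f) 0) ≈ˢ 0ˢ
    vanish zero    = X-*ˢ-zero f
    vanish (suc _) = refl

  ∘ˢ-*ˢ : ∀ f h → (f *ˢ h) ∘ˢ g ≈ˢ (f ∘ˢ g) *ˢ (h ∘ˢ g)
  ∘ˢ-*ˢ f h n = <-rec P step n f h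
    where
    P : ℕ → Set
    -- Quantified over f and h because the induction hypothesis is used for the tail of f.
    P n = ∀ f h → ((f *ˢ h) ∘ˢ g) n ≡ ((f ∘ˢ g) *ˢ (h ∘ˢ g)) n
    step : ∀ n → (∀ {m} → m ℕ.< n → P m) → P n
    step n ih f h = begin
      ((f *ˢ h) ∘ˢ g) n
        ≡⟨ ∘ˢ-unfold (f *ˢ h) n ⟩
      const ((f *ˢ h) 0) n + (g *ˢ (tail (f *ˢ h) ∘ˢ g)) n
        ≡⟨ cong (const ((f *ˢ h) 0) n +_) (*ˢ-cong< {g} n g₀ λ m m<n →
             trans (∘ˢ-+ˢ (scale (f 0) (tail h)) (tail f *ˢ h) m)
               (cong₂ _+_ (trans (∘ˢ-scale (f 0) (tail h) m) (sym (const-*ˢ (f 0) H m)))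
                 (ih m<n (tail f) h))) ⟩
      const ((f *ˢ h) 0) n + (g *ˢ (const (f 0) *ˢ H +ˢ F *ˢ (h ∘ˢ g))) n
        ≡⟨ cong (_+ (g *ˢ (const (f 0) *ˢ H +ˢ F *ˢ (h ∘ˢ g))) n) (const-* n) ⟩
      ((const (f 0) *ˢ const (h 0)) +ˢ g *ˢ (const (f 0) *ˢ H +ˢ F *ˢ (h ∘ˢ g))) n
        ≡⟨ S.+-congˡ {const (f 0) *ˢ const (h 0)} (S.*-congˡ {g} (S.+-congˡ {const (f 0) *ˢ H}
             (S.*-congˡ {F} (∘ˢ-unfold h)))) n ⟩
      ((const (f 0) *ˢ const (h 0)) +ˢ g *ˢ (const (f 0) *ˢ H +ˢ F *ˢ (const (h 0) +ˢ g *ˢ H))) n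
        ≡⟨ ⊗-expand (const (f 0)) (const (h 0)) g H F n ⟩
      ((const (f 0) +ˢ g *ˢ F) *ˢ (const (h 0) +ˢ g *ˢ H)) n
        ≡⟨ *ˢ-cong (∘ˢ-unfold f) (∘ˢ-unfold h) n ⟨
      ((f ∘ˢ g) *ˢ (h ∘ˢ g)) n ∎
      where
      open ≡-Reasoning
      F = tail f ∘ˢ g
      H = tail h ∘ˢ g
      const-* : const ((f *ˢ h) 0) ≈ˢ const (f 0) *ˢ const (h 0)
      const-* zero    = refl
      const-* (suc n) = sym (trans (const-*ˢ (f 0) (const (h 0)) (suc n)) (*-zeroʳ (f 0)))

  -- The Leibniz rule applied to f(g) = f 0 + g · (tail f)(g) leaves one derivative of a
  -- composition. It stands behind a factor g, so it is needed only at smaller indices.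
  chain : ∀ f → D (f ∘ˢ g) ≈ˢ (D f ∘ˢ g) *ˢ D g
  chain f n = <-rec P step n f
    where
    P : ℕ → Set
    P n = ∀ f → D (f ∘ˢ g) n ≡ ((D f ∘ˢ g) *ˢ D g) n
    D-split : ∀ f → D f ≈ˢ tail f +ˢ X *ˢ D (tail f)
    D-split f zero    = trans (*-identityˡ (f 1))
      (sym (trans (cong (f 1 +_) (X-*ˢ-zero (D (tail f)))) (+-identityʳ (f 1))))
    D-split f (suc n) = trans (tail-D f n)
      (cong (f (suc (suc n)) +_) (sym (X-*ˢ (D (tail f)) n)))
    step : ∀ n → (∀ {m} → m ℕ.< n → P m) → P n
    step n ih f = begin
      D (f ∘ˢ g) n
        ≡⟨ D-cong (∘ˢ-unfold f) n ⟩
      D (const (f 0) +ˢ g *ˢ F) n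
        ≡⟨ D-+ˢ (const (f 0)) (g *ˢ F) n ⟩
      D (const (f 0)) n + D (g *ˢ F) n
        ≡⟨ cong₂ _+_ (D-const (f 0) n) (D-*ˢ g F n) ⟩
      0ℚ + ((D g *ˢ F) n + (g *ˢ D F) n)
        ≡⟨ +-identityˡ _ ⟩
      (D g *ˢ F) n + (g *ˢ D F) n
        ≡⟨ cong ((D g *ˢ F) n +_) (*ˢ-cong< {g} n g₀ λ m m<n → ih m<n (tail f)) ⟩
      (D g *ˢ F +ˢ g *ˢ (F′ *ˢ D g)) n
        ≡⟨ ⊗-collect (D g) g F F′ n ⟩
      ((F +ˢ g *ˢ F′) *ˢ D g) n
        ≡⟨ S.*-congʳ {D g} (S.+-congˡ {F} (∘ˢ-X*ˢ (D (tail f)))) n ⟨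
      ((F +ˢ (X *ˢ D (tail f)) ∘ˢ g) *ˢ D g) n
        ≡⟨ S.*-congʳ {D g} (∘ˢ-+ˢ (tail f) (X *ˢ D (tail f))) n ⟨
      (((tail f +ˢ X *ˢ D (tail f)) ∘ˢ g) *ˢ D g) n
        ≡⟨ S.*-congʳ {D g} (∘ˢ-congˡ (D-split f)) n ⟨
      ((D f ∘ˢ g) *ˢ D g) n ∎
      where
      open ≡-Reasoning
      F  = tail f ∘ˢ g
      F′ = D (tail f) ∘ˢ g

  ∘ˢ-X : X ∘ˢ g ≈ˢ g
  ∘ˢ-X = begin
    X ∘ˢ g         ≈⟨ ∘ˢ-congˡ (S.*-identityʳ X) ⟨
    (X *ˢ 1ˢ) ∘ˢ g ≈⟨ ∘ˢ-X*ˢ 1ˢ ⟩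
    g *ˢ (1ˢ ∘ˢ g) ≈⟨ S.*-congˡ {g} (∘ˢ-const 1ℚ) ⟩
    g *ˢ 1ˢ        ≈⟨ S.*-identityʳ g ⟩
    g              ∎
    where open import Relation.Binary.Reasoning.Setoid S.setoid

  ∘ˢ--ˢ : ∀ f h → (f -ˢ h) ∘ˢ g ≈ˢ f ∘ˢ g -ˢ h ∘ˢ g
  ∘ˢ--ˢ f h n = trans (∘ˢ-+ˢ f (-ˢ h) n) (cong ((f ∘ˢ g) n +_)
    (trans (∘ˢ-congˡ { -ˢ h} {scale (- 1ℚ) h} (λ m → minus (h m)) n)
      (trans (∘ˢ-scale (- 1ℚ) h n) (sym (minus ((h ∘ˢ g) n))))))
    where
    minus : ∀ a → - a ≡ - 1ℚ * a
    minus = solve-∀ ℚ-ring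

  ∘ˢ-^ˢ : ∀ f n → (f ^ˢ n) ∘ˢ g ≈ˢ (f ∘ˢ g) ^ˢ n
  ∘ˢ-^ˢ f zero    = ∘ˢ-const 1ℚ
  ∘ˢ-^ˢ f (suc n) m = trans (∘ˢ-*ˢ f (f ^ˢ n) m) (S.*-congˡ {f ∘ˢ g} (∘ˢ-^ˢ f n) m)

-- The differential system

record IsJacobiSystem (x : ℚ) (c : Series) (α β s : Series) : Set where
  field
    α-zero : α 0 ≡ 0ℚ
    β-zero : β 0 ≡ 1ℚ
    s-zero : s 0 ≡ 0ℚ
    D-α    : D α ≈ˢ β *ˢ s
    D-β    : D β ≈ˢ scale x (s *ˢ α)
    D-s    : D s ≈ˢ scale (- (1ℚ + x)) (β *ˢ α) +ˢ (scale x (α *ˢ α) +ˢ β *ˢ β)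
    c≈β-α  : c ≈ˢ β -ˢ α

linear : ℚ → Series → ℚ → Series → Series
linear a f b g = scale a f +ˢ scale b g

linear-*ˢ : ∀ a f b g h → linear a f b g *ˢ h ≈ˢ linear a (f *ˢ h) b (g *ˢ h)
linear-*ˢ a f b g h n = trans (*ˢ-distribʳ h (scale a f) (scale b g) n)
  (cong₂ _+_ (scale-*ˢ a f h n) (scale-*ˢ b g h n))

D-scale : ∀ q f → D (scale q f) ≈ˢ scale q (D f)
D-scale q f n = lemma (nat (suc n)) q (f (suc n))
  where
  lemma : ∀ a b c → a * (b * c) ≡ b * (a * c)
  lemma = solve-∀ ℚ-ring

D-linear : ∀ a f b g → D (linear a f b g) ≈ˢ linear a (D f) b (D g)
D-linear a f b g n = trans (D-+ˢ (scale a f) (scale b g) n)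
  (cong₂ _+_ (D-scale a f n) (D-scale b g n))

^ˢ-2 : ∀ f → f ^ˢ 2 ≈ˢ f *ˢ f
^ˢ-2 f = S.*-congˡ {f} (S.*-identityʳ f)

2ℚ : ℚ
2ℚ = 1ℚ + 1ℚ

D-^ˢ2 : ∀ f → D (f ^ˢ 2) ≈ˢ scale 2ℚ (f *ˢ D f)
D-^ˢ2 f n = begin
  D (f ^ˢ 2) n                  ≡⟨ D-cong (^ˢ-2 f) n ⟩
  D (f *ˢ f) n                  ≡⟨ D-*ˢ f f n ⟩
  (D f *ˢ f) n + (f *ˢ D f) n   ≡⟨ cong (_+ (f *ˢ D f) n) (*ˢ-comm (D f) f n) ⟩
  (f *ˢ D f) n + (f *ˢ D f) n   ≡⟨ lemma ((f *ˢ D f) n) ⟩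
  2ℚ * (f *ˢ D f) n             ∎
  where
  open ≡-Reasoning
  lemma : ∀ a → a + a ≡ 2ℚ * a
  lemma = solve-∀ ℚ-ring

D-1- : ∀ x f → D (1ˢ -ˢ scale x f) ≈ˢ scale (- x) (D f)
D-1- x f n = lemma (nat (suc n)) x (f (suc n))
  where
  lemma : ∀ a x b → a * (0ℚ - x * b) ≡ - x * (a * b)
  lemma = solve-∀ ℚ-ring

-- Half of the derivative of f² = 1 - x s².
D-sqrt : ∀ x {f s} → f ^ˢ 2 ≈ˢ 1ˢ -ˢ scale x (s ^ˢ 2) → f *ˢ D f ≈ˢ scale (- x) s *ˢ D s
D-sqrt x {f} {s} e n = begin
  (f *ˢ D f) n                        ≡⟨ half _ ⟩
  ½ * (2ℚ * (f *ˢ D f) n)             ≡⟨ cong (½ *_) (D-^ˢ2 f n) ⟨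
  ½ * D (f ^ˢ 2) n                    ≡⟨ cong (½ *_) (D-cong e n) ⟩
  ½ * D (1ˢ -ˢ scale x (s ^ˢ 2)) n    ≡⟨ cong (½ *_) (D-1- x (s ^ˢ 2) n) ⟩
  ½ * (- x * D (s ^ˢ 2) n)            ≡⟨ cong (λ a → ½ * (- x * a)) (D-^ˢ2 s n) ⟩
  ½ * (- x * (2ℚ * (s *ˢ D s) n))     ≡⟨ swap x _ ⟩
  ½ * (2ℚ * (- x * (s *ˢ D s) n))     ≡⟨ half _ ⟨
  - x * (s *ˢ D s) n                  ≡⟨ scale-*ˢ (- x) s (D s) n ⟨
  (scale (- x) s *ˢ D s) n            ∎
  where
  open ≡-Reasoning
  half : ∀ a → a ≡ ½ * (2ℚ * a)
  half a = trans (sym (*-identityˡ a)) (*-assoc ½ 2ℚ a)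
  swap : ∀ x a → ½ * (- x * (2ℚ * a)) ≡ ½ * (2ℚ * (- x * a))
  swap = solve-∀ ℚ-ring

k²<1 : ∀ {k} → 0ℚ < k → k < 1ℚ → k ^ 2 < 1ℚ
k²<1 {k} 0<k k<1 = <-trans
  (subst₂ _<_ (cong (k *_) (sym (*-identityʳ k))) (*-identityʳ k)
    (*-monoʳ-<-pos k {{positive 0<k}} k<1))
  k<1

module _ {k : ℚ} {c : Series} (0<k : 0ℚ < k) (k<1 : k < 1ℚ) (cn : IsCn k c) where
  private
    x = k ^ 2
    s = proj₁ cn
    w = proj₁ (proj₁ (proj₂ cn))

    w₀ : w 0 ≡ 1ℚ
    w₀ = proj₁ (proj₁ (proj₂ (proj₁ (proj₂ cn))))

    s₀ : s 0 ≡ 0ℚ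
    s₀ = proj₁ (proj₂ (proj₂ (proj₁ (proj₂ cn))))

    c₀ : c 0 ≡ 1ℚ
    c₀ = proj₁ (proj₂ (proj₂ cn))

    open Composition s s₀

    W p q d : Series
    W = w ∘ˢ s
    p = 1ˢ -ˢ s ^ˢ 2
    q = 1ˢ -ˢ scale x (s ^ˢ 2)
    -- The hypotheses do not mention dn. Since W should be 1/(cn dn) and q should be dn², this
    -- product is the branch of √q with value 1 at 0.
    d = W *ˢ c *ˢ q

    W*Ds : W *ˢ D s ≈ˢ 1ˢ
    W*Ds = begin
      W *ˢ D s              ≈⟨ S.*-congʳ {D s} (∘ˢ-congˡ (D-∫ w)) ⟨
      (D (∫ w) ∘ˢ s) *ˢ D s ≈⟨ chain (∫ w) ⟨
      D (∫ w ∘ˢ s)          ≈⟨ D-cong (proj₂ (proj₂ (proj₂ (proj₁ (proj₂ cn))))) ⟩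
      D X                   ≈⟨ D-X ⟩
      1ˢ                    ∎
      where
      open import Relation.Binary.Reasoning.Setoid S.setoid
      D-X : D X ≈ˢ 1ˢ
      D-X zero    = refl
      D-X (suc n) = *-zeroʳ (nat (suc (suc n)))

    square-∘ˢ : (X ^ˢ 2) ∘ˢ s ≈ˢ s ^ˢ 2
    square-∘ˢ = begin
      (X ^ˢ 2) ∘ˢ s           ≈⟨ ∘ˢ-^ˢ X 2 ⟩
      (X ∘ˢ s) ^ˢ 2         ≈⟨ ^ˢ-2 (X ∘ˢ s) ⟩
      (X ∘ˢ s) *ˢ (X ∘ˢ s)  ≈⟨ *ˢ-cong ∘ˢ-X ∘ˢ-X ⟩
      s *ˢ s                ≈⟨ ^ˢ-2 s ⟨
      s ^ˢ 2                ∎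
      where open import Relation.Binary.Reasoning.Setoid S.setoid

    1--∘ˢ : ∀ {f h} → f ∘ˢ s ≈ˢ h → (1ˢ -ˢ f) ∘ˢ s ≈ˢ 1ˢ -ˢ h
    1--∘ˢ {f} e n = trans (∘ˢ--ˢ 1ˢ f n) (cong₂ _-_ (∘ˢ-const 1ℚ n) (e n))

    W²pq : (W *ˢ W) *ˢ (p *ˢ q) ≈ˢ 1ˢ
    W²pq = begin
      (W *ˢ W) *ˢ (p *ˢ q)
        ≈⟨ *ˢ-cong {(w ^ˢ 2) ∘ˢ s} {W *ˢ W} (≈ˢ-trans {g = W ^ˢ 2} (∘ˢ-^ˢ w 2) (^ˢ-2 W))
             (*ˢ-cong (1--∘ˢ {X ^ˢ 2} square-∘ˢ) (1--∘ˢ {const x *ˢ X ^ˢ 2} kX²)) ⟨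
      ((w ^ˢ 2) ∘ˢ s) *ˢ (((1ˢ -ˢ X ^ˢ 2) ∘ˢ s) *ˢ ((1ˢ -ˢ const x *ˢ X ^ˢ 2) ∘ˢ s))
        ≈⟨ S.*-congˡ {(w ^ˢ 2) ∘ˢ s} (∘ˢ-*ˢ (1ˢ -ˢ X ^ˢ 2) (1ˢ -ˢ const x *ˢ X ^ˢ 2)) ⟨
      ((w ^ˢ 2) ∘ˢ s) *ˢ (((1ˢ -ˢ X ^ˢ 2) *ˢ (1ˢ -ˢ const x *ˢ X ^ˢ 2)) ∘ˢ s)
        ≈⟨ ∘ˢ-*ˢ (w ^ˢ 2) ((1ˢ -ˢ X ^ˢ 2) *ˢ (1ˢ -ˢ const x *ˢ X ^ˢ 2)) ⟨
      (w ^ˢ 2 *ˢ ((1ˢ -ˢ X ^ˢ 2) *ˢ (1ˢ -ˢ const x *ˢ X ^ˢ 2))) ∘ˢ s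
        ≈⟨ ∘ˢ-congˡ (proj₂ (proj₁ (proj₂ (proj₁ (proj₂ cn))))) ⟩
      1ˢ ∘ˢ s
        ≈⟨ ∘ˢ-const 1ℚ ⟩
      1ˢ ∎
      where
      open import Relation.Binary.Reasoning.Setoid S.setoid
      kX² : (const x *ˢ X ^ˢ 2) ∘ˢ s ≈ˢ scale x (s ^ˢ 2)
      kX² n = trans (∘ˢ-congˡ (const-*ˢ x (X ^ˢ 2)) n)
        (trans (∘ˢ-scale x (X ^ˢ 2) n) (cong (x *_) (square-∘ˢ n)))

    c² : c *ˢ c ≈ˢ p
    c² = ≈ˢ-trans (≈ˢ-sym (^ˢ-2 c)) (proj₂ (proj₂ (proj₂ cn)))

    d² : d *ˢ d ≈ˢ q
    d² = ^2-inverse {W} {c} {p} {q} W²pq c²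

    c*d : c *ˢ d ≈ˢ D s
    c*d = inverse-unique {W} {D s} {c} {p} {q} W²pq W*Ds c²

    D-c : D c ≈ˢ scale (- 1ℚ) s *ˢ d
    D-c = cancel-unit {W} {D s} {c} {d} {D c} {scale (- 1ℚ) s} W*Ds c*d (D-sqrt 1ℚ {c} {s} λ n →
      trans (proj₂ (proj₂ (proj₂ cn)) n) (cong (λ a → 1ˢ n - a) (sym (*-identityˡ ((s ^ˢ 2) n)))))

    D-d : D d ≈ˢ scale (- x) s *ˢ c
    D-d = cancel-unit {W} {D s} {d} {c} {D d} {scale (- x) s} W*Ds (≈ˢ-trans (*ˢ-comm d c) c*d)
      (D-sqrt x {d} {s} (≈ˢ-trans {g = d *ˢ d} (^ˢ-2 d) d²))

    d₀ : d 0 ≡ 1ℚ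
    d₀ = begin
      ((w 0 * 1ℚ + 0ℚ) * c 0 + 0ℚ) * (1ℚ - x * (s 0 * a + 0ℚ)) + 0ℚ
        ≡⟨ cong₂ (λ u v → ((u * 1ℚ + 0ℚ) * v + 0ℚ) * (1ℚ - x * (s 0 * a + 0ℚ)) + 0ℚ) w₀ c₀ ⟩
      (1ℚ * 1ℚ + 0ℚ) * (1ℚ - x * (s 0 * a + 0ℚ)) + 0ℚ
        ≡⟨ cong (λ u → (1ℚ * 1ℚ + 0ℚ) * (1ℚ - x * (u * a + 0ℚ)) + 0ℚ) s₀ ⟩
      (1ℚ * 1ℚ + 0ℚ) * (1ℚ - x * (0ℚ * a + 0ℚ)) + 0ℚ
        ≡⟨ lemma x a ⟩
      1ℚ ∎
      where
      open ≡-Reasoning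
      a = (s *ˢ 1ˢ) 0
      lemma : ∀ x a → (1ℚ * 1ℚ + 0ℚ) * (1ℚ - x * (0ℚ * a + 0ℚ)) + 0ℚ ≡ 1ℚ
      lemma = solve-∀ ℚ-ring

    instance
      1-x≢0 : NonZero (1ℚ - x)
      1-x≢0 = ≢-nonZero {1ℚ - x} λ 1-x≡0 → <⇒≢ {x} {1ℚ} (k²<1 0<k k<1) (begin
        x                ≡⟨ lemma x ⟩
        1ℚ - (1ℚ - x)    ≡⟨ cong (λ a → 1ℚ - a) 1-x≡0 ⟩
        1ℚ               ∎)
        where
        open ≡-Reasoning
        lemma : ∀ x → x ≡ 1ℚ - (1ℚ - x)
        lemma = solve-∀ ℚ-ring

    r : ℚ
    r = 1/ (1ℚ - x)

    r*[1-x] : r * (1ℚ - x) ≡ 1ℚ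
    r*[1-x] = *-inverseˡ (1ℚ - x)

    α β : Series
    α = linear r d (- r) c
    β = linear r d (- (r * x)) c

    c≈ : c ≈ˢ linear 1ℚ β (- 1ℚ) α
    c≈ n = trans (sym (*-identityˡ (c n))) (trans (cong (_* c n) (sym r*[1-x])) (lemma x r (c n) (d n)))
      where
      lemma : ∀ x r c d → r * (1ℚ - x) * c ≡ 1ℚ * (r * d + - (r * x) * c) + - 1ℚ * (r * d + - r * c)
      lemma = solve-∀ ℚ-ring

    d≈ : d ≈ˢ linear 1ℚ β (- x) α
    d≈ n = trans (sym (*-identityˡ (d n))) (trans (cong (_* d n) (sym r*[1-x])) (lemma x r (c n) (d n)))
      where
      lemma : ∀ x r c d → r * (1ℚ - x) * d ≡ 1ℚ * (r * d + - (r * x) * c) + - x * (r * d + - r * c)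
      lemma = solve-∀ ℚ-ring

    D-lin : ∀ b n → D (linear r d b c) n ≡ r * (- x * (s *ˢ c) n) + b * (- 1ℚ * (s *ˢ d) n)
    D-lin b n = trans (D-linear r d b c n) (cong₂ (λ u v → r * u + b * v)
      (trans (D-d n) (scale-*ˢ (- x) s c n))
      (trans (D-c n) (scale-*ˢ (- 1ℚ) s d n)))

    lin-*s : ∀ b n → (linear r d b c *ˢ s) n ≡ r * (s *ˢ d) n + b * (s *ˢ c) n
    lin-*s b n = trans (linear-*ˢ r d b c s n)
      (cong₂ (λ u v → r * u + b * v) (*ˢ-comm d s n) (*ˢ-comm c s n))

  jacobiSystem : Σ[ α ∈ Series ] Σ[ β ∈ Series ] Σ[ s ∈ Series ] IsJacobiSystem x c α β s
  jacobiSystem = α , β , s , record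
    { α-zero = trans (cong₂ (λ u v → r * u + - r * v) d₀ c₀) (lemma₁ r)
    ; β-zero = trans (cong₂ (λ u v → r * u + - (r * x) * v) d₀ c₀) (trans (lemma₂ r x) r*[1-x])
    ; s-zero = s₀
    ; D-α = λ n → trans (D-lin (- r) n)
        (trans (lemma₃ r x ((s *ˢ c) n) ((s *ˢ d) n)) (sym (lin-*s (- (r * x)) n)))
    ; D-β = λ n → trans (D-lin (- (r * x)) n)
        (trans (lemma₄ r x ((s *ˢ c) n) ((s *ˢ d) n))
          (cong (x *_) (sym (trans (*ˢ-comm s α n) (lin-*s (- r) n)))))
    -- sn' = cn dn = (β - α)(β - x α); the mixed term produces the coefficient τ = - (1 + x).
    ; D-s = λ n → begin
        D s n
          ≡⟨ c*d n ⟨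
        (c *ˢ d) n
          ≡⟨ S.*-congʳ {d} c≈ n ⟩
        (linear 1ℚ β (- 1ℚ) α *ˢ d) n
          ≡⟨ linear-*ˢ 1ℚ β (- 1ℚ) α d n ⟩
        1ℚ * (β *ˢ d) n + - 1ℚ * (α *ˢ d) n
          ≡⟨ cong₂ (λ u v → 1ℚ * u + - 1ℚ * v) (*d β n) (*d α n) ⟩
        1ℚ * (1ℚ * (β *ˢ β) n + - x * (α *ˢ β) n) + - 1ℚ * (1ℚ * (β *ˢ α) n + - x * (α *ˢ α) n)
          ≡⟨ cong (λ u → 1ℚ * (1ℚ * (β *ˢ β) n + - x * u) + - 1ℚ * (1ℚ * (β *ˢ α) n + - x * (α *ˢ α) n))
               (*ˢ-comm α β n) ⟩
        1ℚ * (1ℚ * (β *ˢ β) n + - x * (β *ˢ α) n) + - 1ℚ * (1ℚ * (β *ˢ α) n + - x * (α *ˢ α) n)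
          ≡⟨ lemma₅ x ((β *ˢ β) n) ((β *ˢ α) n) ((α *ˢ α) n) ⟩
        - (1ℚ + x) * (β *ˢ α) n + (x * (α *ˢ α) n + (β *ˢ β) n) ∎
    ; c≈β-α = λ n → trans (c≈ n) (lemma₆ (β n) (α n))
    }
    where
    open ≡-Reasoning
    *d : ∀ f n → (f *ˢ d) n ≡ 1ℚ * (β *ˢ f) n + - x * (α *ˢ f) n
    *d f n = trans (*ˢ-comm f d n) (trans (S.*-congʳ {f} d≈ n) (linear-*ˢ 1ℚ β (- x) α f n))
    lemma₁ : ∀ r → r * 1ℚ + - r * 1ℚ ≡ 0ℚ
    lemma₁ = solve-∀ ℚ-ring
    lemma₂ : ∀ r x → r * 1ℚ + - (r * x) * 1ℚ ≡ r * (1ℚ - x)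
    lemma₂ = solve-∀ ℚ-ring
    lemma₃ : ∀ r x a b → r * (- x * a) + - r * (- 1ℚ * b) ≡ r * b + - (r * x) * a
    lemma₃ = solve-∀ ℚ-ring
    lemma₄ : ∀ r x a b → r * (- x * a) + - (r * x) * (- 1ℚ * b) ≡ x * (r * b + - r * a)
    lemma₄ = solve-∀ ℚ-ring
    lemma₅ : ∀ x u v z → 1ℚ * (1ℚ * u + - x * v) + - 1ℚ * (1ℚ * v + - x * z) ≡
                         - (1ℚ + x) * v + (x * z + u)
    lemma₅ = solve-∀ ℚ-ring
    lemma₆ : ∀ u v → 1ℚ * u + - 1ℚ * v ≡ u - v
    lemma₆ = solve-∀ ℚ-ring

-- Graded nonnegative functions

τ : ℚ → ℚ
τ x = - (1ℚ + x)

-- τ^(e/2), read as 0 for odd e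
τ^½ : ℕ → ℚ → ℚ
τ^½ 0             x = 1ℚ
τ^½ 1             x = 0ℚ
τ^½ (suc (suc e)) x = τ x * τ^½ e x

module _ {K : Set} (x : K → ℚ) where

  -- Functions of weight e - 2: the shift makes room for the two lowest
  -- coefficients of α, which vanish. In cons with e < 2, the truncated e ∸ 2 = 0
  -- forces g = 0.
  data Graded : ℕ → (K → ℚ) → Set where
    nil₀ : ∀ {f} → (∀ k → f k ≡ 0ℚ) → Graded 0 f
    nil₁ : ∀ {f} → (∀ k → f k ≡ 0ℚ) → Graded 1 f
    cons : ∀ {e f g} q → 0ℚ ≤ q → Graded (e ∸ 2) g →
           (∀ k → f k ≡ q * τ^½ e (x k) + x k * g k) → Graded (2 ℕ.+ e) f

  -- Only the coefficient of the pure power of τ is strictly positive. It becomes γ_0, hence the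
  -- constant term of a and, by symmetry, its leading coefficient.
  data GradedPos : ℕ → (K → ℚ) → Set where
    cons : ∀ {e f g} q → 0ℚ < q → Graded (e ∸ 2) g →
           (∀ k → f k ≡ q * τ^½ e (x k) + x k * g k) → GradedPos (2 ℕ.+ e) f

module _ {K : Set} {x : K → ℚ} where

  respects : ∀ {e f g} → (∀ k → f k ≡ g k) → Graded x e f → Graded x e g
  respects e (nil₀ z)         = nil₀ λ k → trans (sym (e k)) (z k)
  respects e (nil₁ z)         = nil₁ λ k → trans (sym (e k)) (z k)
  respects e (cons q 0≤q p z) = cons q 0≤q p λ k → trans (sym (e k)) (z k)

  respectsPos : ∀ {e f g} → (∀ k → f k ≡ g k) → GradedPos x e f → GradedPos x e g
  respectsPos e (cons q 0<q p z) = cons q 0<q p λ k → trans (sym (e k)) (z k)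

  graded-0 : ∀ e {f} → (∀ k → f k ≡ 0ℚ) → Graded x e f
  graded-0 0 z = nil₀ z
  graded-0 1 z = nil₁ z
  graded-0 (suc (suc e)) {f} z = cons 0ℚ ≤-refl (lower e) λ k →
    trans (z k) (lemma (τ^½ e (x k)) (x k))
    where
    lemma : ∀ t x → 0ℚ ≡ 0ℚ * t + x * 0ℚ
    lemma = solve-∀ ℚ-ring
    lower : ∀ e → Graded x (e ∸ 2) (λ _ → 0ℚ)
    lower 0             = nil₀ λ _ → refl
    lower 1             = nil₀ λ _ → refl
    lower (suc (suc e)) = graded-0 e λ _ → refl

  private
    plus-cons : ∀ q q′ t x a b → (q * t + x * a) + (q′ * t + x * b) ≡ (q + q′) * t + x * (a + b)
    plus-cons = solve-∀ ℚ-ring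

    times-cons : ∀ r q t x a → r * (q * t + x * a) ≡ r * q * t + x * (r * a)
    times-cons = solve-∀ ℚ-ring

    τ*-cons : ∀ q s t x a → s * (q * t + x * a) ≡ q * (s * t) + x * (s * a)
    τ*-cons = solve-∀ ℚ-ring

  plus : ∀ {e f g} → Graded x e f → Graded x e g → Graded x e (λ k → f k + g k)
  plus (nil₀ z) (nil₀ z′) = nil₀ λ k → cong₂ _+_ (z k) (z′ k)
  plus (nil₁ z) (nil₁ z′) = nil₁ λ k → cong₂ _+_ (z k) (z′ k)
  plus {suc (suc e)} (cons q 0≤q p z) (cons q′ 0≤q′ p′ z′) =
    cons (q + q′) (+-mono-≤ 0≤q 0≤q′) (plus p p′) λ k →
      trans (cong₂ _+_ (z k) (z′ k)) (plus-cons q q′ (τ^½ e (x k)) (x k) _ _)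

  plusPos : ∀ {e f g} → GradedPos x e f → Graded x e g → GradedPos x e (λ k → f k + g k)
  plusPos {suc (suc e)} (cons q 0<q p z) (cons q′ 0≤q′ p′ z′) =
    cons (q + q′) (+-mono-<-≤ 0<q 0≤q′) (plus p p′) λ k →
      trans (cong₂ _+_ (z k) (z′ k)) (plus-cons q q′ (τ^½ e (x k)) (x k) _ _)

  times : ∀ {e f} r → 0ℚ ≤ r → Graded x e f → Graded x e (λ k → r * f k)
  times r 0≤r (nil₀ z) = nil₀ λ k → trans (cong (r *_) (z k)) (*-zeroʳ r)
  times r 0≤r (nil₁ z) = nil₁ λ k → trans (cong (r *_) (z k)) (*-zeroʳ r)
  times {suc (suc e)} r 0≤r (cons q 0≤q p z) =
    cons (r * q) (nonNegative⁻¹ (r * q) {{nonNeg*nonNeg⇒nonNeg r {{nonNegative 0≤r}} q {{nonNegative 0≤q}}}})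
      (times r 0≤r p) λ k → trans (cong (r *_) (z k)) (times-cons r q (τ^½ e (x k)) (x k) _)

  timesPos : ∀ {e f} r → 0ℚ < r → GradedPos x e f → GradedPos x e (λ k → r * f k)
  timesPos {suc (suc e)} r 0<r (cons q 0<q p z) =
    cons (r * q) (positive⁻¹ (r * q) {{pos*pos⇒pos r {{positive 0<r}} q {{positive 0<q}}}})
      (times r (ℚₚ.<⇒≤ 0<r) p) λ k → trans (cong (r *_) (z k)) (times-cons r q (τ^½ e (x k)) (x k) _)

  x* : ∀ {e f} → Graded x e f → Graded x (4 ℕ.+ e) (λ k → x k * f k)
  x* {e} p = cons 0ℚ ≤-refl p λ k → lemma (τ^½ (2 ℕ.+ e) (x k)) _
    where
    lemma : ∀ t a → a ≡ 0ℚ * t + a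
    lemma = solve-∀ ℚ-ring

  mutual
    τ* : ∀ {e f} → Graded x e f → Graded x (2 ℕ.+ e) (λ k → τ (x k) * f k)
    τ* (nil₀ z) = graded-0 2 λ k → trans (cong (τ (x k) *_) (z k)) (*-zeroʳ (τ (x k)))
    τ* (nil₁ z) = graded-0 3 λ k → trans (cong (τ (x k) *_) (z k)) (*-zeroʳ (τ (x k)))
    τ* {suc (suc e)} (cons q 0≤q p z) =
      cons q 0≤q (τ*-lower e p) λ k →
        trans (cong (τ (x k) *_) (z k)) (τ*-cons q (τ (x k)) (τ^½ e (x k)) (x k) _)

    -- For e < 2 the truncated index does not reflect the weight of g, but it forces g = 0, so the
    -- statement survives.
    τ*-lower : ∀ e {g} → Graded x (e ∸ 2) g → Graded x e (λ k → τ (x k) * g k)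
    τ*-lower 0 (nil₀ z) = nil₀ λ k → trans (cong (τ (x k) *_) (z k)) (*-zeroʳ (τ (x k)))
    τ*-lower 1 (nil₀ z) = nil₁ λ k → trans (cong (τ (x k) *_) (z k)) (*-zeroʳ (τ (x k)))
    τ*-lower (suc (suc e)) p = τ* p

  τ*Pos : ∀ {e f} → GradedPos x e f → GradedPos x (2 ℕ.+ e) (λ k → τ (x k) * f k)
  τ*Pos {suc (suc e)} (cons q 0<q p z) =
    cons q 0<q (τ*-lower e p) λ k →
      trans (cong (τ (x k) *_) (z k)) (τ*-cons q (τ (x k)) (τ^½ e (x k)) (x k) _)

  τ^½* : ∀ e {f g} → Graded x f g → Graded x (e ℕ.+ f) (λ k → τ^½ e (x k) * g k)
  τ^½* 0 p = respects (λ k → sym (*-identityˡ _)) p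
  τ^½* 1 {f} {g} p = graded-0 (suc f) λ k → *-zeroˡ (g k)
  τ^½* (suc (suc e)) {f} {g} p = respects (λ k → sym (*-assoc (τ (x k)) (τ^½ e (x k)) (g k))) (τ* (τ^½* e p))

  -- Weights add, so with the shift by two the indices e and 2 + d give e + d; writing the second
  -- index as 2 + d avoids a subtraction. The first factor is taken apart: its power of τ acts on g
  -- directly, and its remainder carries a factor x.
  product : ∀ {e f} d {g} → Graded x e f → Graded x (2 ℕ.+ d) g → Graded x (e ℕ.+ d) (λ k → f k * g k)
  product d {g} (nil₀ z) p = graded-0 d λ k → trans (cong (_* g k) (z k)) (*-zeroˡ (g k))
  product d {g} (nil₁ z) p = graded-0 (suc d) λ k → trans (cong (_* g k) (z k)) (*-zeroˡ (g k))
  product {suc (suc e)} {f} d {g} (cons {g = h} q 0≤q p z) r = respects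
    (λ k → trans (lemma q (τ^½ e (x k)) (x k) (h k) (g k)) (cong (_* g k) (sym (z k))))
    (plus
      (times q 0≤q (subst (λ m → Graded x m (λ k → τ^½ e (x k) * g k))
        (trans (ℕₚ.+-suc e (suc d)) (cong suc (ℕₚ.+-suc e d))) (τ^½* e r)))
      (rest e p))
    where
    lemma : ∀ q t x h g → q * (t * g) + x * (h * g) ≡ (q * t + x * h) * g
    lemma = solve-∀ ℚ-ring
    vanish : (∀ k → h k ≡ 0ℚ) → ∀ k → x k * (h k * g k) ≡ 0ℚ
    vanish z k = trans (cong (λ a → x k * (a * g k)) (z k))
      (trans (cong (x k *_) (*-zeroˡ (g k))) (*-zeroʳ (x k)))
    rest : ∀ e → Graded x (e ∸ 2) h → Graded x (2 ℕ.+ (e ℕ.+ d)) (λ k → x k * (h k * g k))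
    rest 0 (nil₀ z) = graded-0 (2 ℕ.+ d) (vanish z)
    rest 1 (nil₀ z) = graded-0 (3 ℕ.+ d) (vanish z)
    rest (suc (suc e)) p = x* (product d p r)

  -- The weight four of x outweighs the shift, so no lower bound on the indices is required: for d <
  -- 2 the factor g vanishes. This covers the products with the low coefficients of α.
  x*product : ∀ {e d f g} → Graded x e f → Graded x d g →
              Graded x (2 ℕ.+ (e ℕ.+ d)) (λ k → x k * (f k * g k))
  x*product {e} {0} {f} {g} p (nil₀ z) = graded-0 (2 ℕ.+ (e ℕ.+ 0)) λ k →
    trans (cong (λ a → x k * (f k * a)) (z k))
      (trans (cong (x k *_) (*-zeroʳ (f k))) (*-zeroʳ (x k)))
  x*product {e} {1} {f} {g} p (nil₁ z) = graded-0 (2 ℕ.+ (e ℕ.+ 1)) λ k →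
    trans (cong (λ a → x k * (f k * a)) (z k))
      (trans (cong (x k *_) (*-zeroʳ (f k))) (*-zeroʳ (x k)))
  x*product {e} {suc (suc d)} {f} {g} p r =
    subst (λ m → Graded x (2 ℕ.+ m) (λ k → x k * (f k * g k)))
      (sym (trans (ℕₚ.+-suc e (suc d)) (cong suc (ℕₚ.+-suc e d))))
      (x* (product d p r))

  graded-sum : ∀ {e} n {t : Fin n → K → ℚ} → (∀ i → Graded x e (t i)) →
               Graded x e (λ k → sum (λ i → t i k))
  graded-sum {e} zero    p = graded-0 e λ k → refl
  graded-sum     (suc n) p = plus (p zero) (graded-sum n (p ∘ suc))

  module _ {e : ℕ} (f g : K → Series) m
    (p : ∀ i → i ℕ.≤ m → Graded x e (λ k → f k i * g k (m ∸ i))) where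

    graded-*ˢ : Graded x e (λ k → (f k *ˢ g k) m)
    graded-*ˢ = graded-sum (suc m) λ i → p (toℕ i) (ℕₚ.≤-pred (toℕ<n i))

    gradedPos-*ˢ : GradedPos x e (λ k → f k 0 * g k m) → GradedPos x e (λ k → (f k *ˢ g k) m)
    gradedPos-*ˢ p₀ = plusPos p₀ (graded-sum m λ i → p (suc (toℕ i)) (toℕ<n i))

-- Weights of the Taylor coefficients of α, β and sn

0<1/suc : ∀ n → 0ℚ < ℤ.+ 1 / suc n
0<1/suc n = positive⁻¹ (ℤ.+ 1 / suc n) {{normalize-pos 1 (suc n)}}

D⇒coeff : ∀ {f g} → D f ≈ˢ g → ∀ n → (ℤ.+ 1 / suc n) * g n ≡ f (suc n)
D⇒coeff {f} {g} e n = trans (cong ((ℤ.+ 1 / suc n) *_) (sym (e n)))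
  (trans (sym (*-assoc (ℤ.+ 1 / suc n) (nat (suc n)) (f (suc n))))
    (trans (cong (_* f (suc n)) (1/-nat n)) (*-identityˡ (f (suc n)))))

module JacobiCoefficients
  {K : Set} (x : K → ℚ) (c α β s : K → Series)
  (system : ∀ k → IsJacobiSystem (x k) (c k) (α k) (β k) (s k)) where

  open module J k = IsJacobiSystem (system k)

  private
    -- Coefficient i has weight i - 2 in α, i in β and i - 1 in sn. These weights make the three
    -- differential equations homogeneous, a derivative raising the weight attached to an index by
    -- one.
    GradedAt : ℕ → Set
    GradedAt i = Graded x i (λ k → α k i) × Graded x (2 ℕ.+ i) (λ k → β k i) ×
                 Graded x (1 ℕ.+ i) (λ k → s k i)

    reindex : ∀ {e e′ f} → e ≡ e′ → Graded x e f → Graded x e′ f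
    reindex {f = f} eq = subst (λ m → Graded x m f) eq

    module Step (m : ℕ) (ih : ∀ i → i ℕ.≤ m → GradedAt i) where
      αᵍ : ∀ i → i ℕ.≤ m → Graded x i (λ k → α k i)
      αᵍ i i≤m = proj₁ (ih i i≤m)

      βᵍ : ∀ i → i ℕ.≤ m → Graded x (2 ℕ.+ i) (λ k → β k i)
      βᵍ i i≤m = proj₁ (proj₂ (ih i i≤m))

      sᵍ : ∀ i → i ℕ.≤ m → Graded x (1 ℕ.+ i) (λ k → s k i)
      sᵍ i i≤m = proj₂ (proj₂ (ih i i≤m))

      -- The factors are swapped because `product` expects the one of index at least two in second
      -- place, and β always qualifies.
      βs : ∀ i → i ℕ.≤ m → Graded x (suc m) (λ k → β k i * s k (m ∸ i))
      βs i i≤m = respects (λ k → *-comm (s k (m ∸ i)) (β k i))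
        (reindex (cong suc (ℕₚ.m∸n+n≡m i≤m)) (product i (sᵍ (m ∸ i) (ℕₚ.m∸n≤m m i)) (βᵍ i i≤m)))

      βα : ∀ i → i ℕ.≤ m → Graded x m (λ k → β k i * α k (m ∸ i))
      βα i i≤m = respects (λ k → *-comm (α k (m ∸ i)) (β k i))
        (reindex (ℕₚ.m∸n+n≡m i≤m) (product i (αᵍ (m ∸ i) (ℕₚ.m∸n≤m m i)) (βᵍ i i≤m)))

      ββ : ∀ i → i ℕ.≤ m → Graded x (2 ℕ.+ m) (λ k → β k i * β k (m ∸ i))
      ββ i i≤m = reindex (cong (2 ℕ.+_) (ℕₚ.m+[n∸m]≡n i≤m))
        (product (m ∸ i) (βᵍ i i≤m) (βᵍ (m ∸ i) (ℕₚ.m∸n≤m m i)))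

      xαα+ββ : Graded x (2 ℕ.+ m) (λ k → x k * (α k *ˢ α k) m + (β k *ˢ β k) m)
      xαα+ββ = plus
        (respects (λ k → sym (*-distribˡ-sum {suc m} (x k) (λ i → α k (toℕ i) * α k (m ∸ toℕ i))))
          (graded-sum (suc m) λ i → reindex
            (cong (2 ℕ.+_) (ℕₚ.m+[n∸m]≡n (ℕₚ.≤-pred (toℕ<n i))))
            (x*product (αᵍ (toℕ i) (ℕₚ.≤-pred (toℕ<n i)))
                       (αᵍ (m ∸ toℕ i) (ℕₚ.m∸n≤m m (toℕ i))))))
        (graded-*ˢ β β m ββ)

      0≤r = ℚₚ.<⇒≤ (0<1/suc m)

      step : GradedAt (suc m)
      step = respects (λ k → D⇒coeff {α k} (D-α k) m) (times (ℤ.+ 1 / suc m) 0≤r (graded-*ˢ β s m βs))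
           , respects (λ k → D⇒coeff {β k} (D-β k) m) (times (ℤ.+ 1 / suc m) 0≤r
               (respects (λ k → sym (*-distribˡ-sum {suc m} (x k) (λ i → s k (toℕ i) * α k (m ∸ toℕ i))))
                 (graded-sum (suc m) λ i → reindex
                   (cong (3 ℕ.+_) (ℕₚ.m+[n∸m]≡n (ℕₚ.≤-pred (toℕ<n i))))
                   (x*product (sᵍ (toℕ i) (ℕₚ.≤-pred (toℕ<n i)))
                              (αᵍ (m ∸ toℕ i) (ℕₚ.m∸n≤m m (toℕ i)))))))
           , respects (λ k → D⇒coeff {s k} (D-s k) m) (times (ℤ.+ 1 / suc m) 0≤r
               (plus (τ* (graded-*ˢ β α m βα)) xαα+ββ))

      α-pos : GradedPos x (suc m) (λ k → s k m) → GradedPos x (suc m) (λ k → α k (suc m))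
      α-pos p = respectsPos (λ k → D⇒coeff {α k} (D-α k) m) (timesPos (ℤ.+ 1 / suc m) (0<1/suc m)
        (gradedPos-*ˢ β s m βs
          (respectsPos (λ k → sym (trans (cong (_* s k m) (β-zero k)) (*-identityˡ (s k m)))) p)))

      s-pos : GradedPos x m (λ k → α k m) → GradedPos x (2 ℕ.+ m) (λ k → s k (suc m))
      s-pos p = respectsPos (λ k → D⇒coeff {s k} (D-s k) m) (timesPos (ℤ.+ 1 / suc m) (0<1/suc m)
        (plusPos
          (τ*Pos (gradedPos-*ˢ β α m βα
            (respectsPos (λ k → sym (trans (cong (_* α k m) (β-zero k)) (*-identityˡ (α k m)))) p)))
          xαα+ββ))

    one-cons : ∀ x → 1ℚ ≡ 1ℚ * 1ℚ + x * 0ℚ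
    one-cons = solve-∀ ℚ-ring

    graded≤ : ∀ m i → i ℕ.≤ m → GradedAt i
    graded≤ zero zero z≤n =
        nil₀ α-zero
      , cons {g = λ _ → 0ℚ} 1ℚ (ℚₚ.<⇒≤ (positive⁻¹ 1ℚ)) (nil₀ λ _ → refl)
          (λ k → trans (β-zero k) (one-cons (x k)))
      , nil₁ s-zero
    graded≤ (suc m) i i≤1+m with ℕₚ.m≤n⇒m<n∨m≡n i≤1+m
    ... | inj₁ i<1+m = graded≤ m i (ℕₚ.≤-pred i<1+m)
    ... | inj₂ refl  = Step.step m (graded≤ m)

  α-graded : ∀ m → Graded x m (λ k → α k m)
  α-graded m = proj₁ (graded≤ m m ℕₚ.≤-refl)

  s-graded : ∀ m → Graded x (suc m) (λ k → s k m)
  s-graded m = proj₂ (proj₂ (graded≤ m m ℕₚ.≤-refl))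

  s-one : ∀ k → s k 1 ≡ 1ℚ
  s-one k = trans (sym (D⇒coeff {s k} (D-s k) 0))
    (trans (cong₂ (λ a b → (ℤ.+ 1 / 1) * (τ (x k) * (b * a + 0ℚ) + (x k * (a * a + 0ℚ) + (b * b + 0ℚ))))
             (α-zero k) (β-zero k))
      (lemma (x k)))
    where
    lemma : ∀ x → 1ℚ * (- (1ℚ + x) * (1ℚ * 0ℚ + 0ℚ) + (x * (0ℚ * 0ℚ + 0ℚ) + (1ℚ * 1ℚ + 0ℚ))) ≡ 1ℚ
    lemma = solve-∀ ℚ-ring

  mutual
    -- Since β 0 = 1, the summand β 0 · sn of α' hands the positive leading coefficient from sn to
    -- α, and the summand τ · β 0 · α of sn' hands it back. The exchange starts from the coefficient
    -- 1 of u in sn.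
    α-gradedPos : ∀ n → GradedPos x (2 ℕ.+ n ℕ.* 2) (λ k → α k (2 ℕ.+ n ℕ.* 2))
    α-gradedPos n = Step.α-pos (1 ℕ.+ n ℕ.* 2) (graded≤ (1 ℕ.+ n ℕ.* 2)) (s-gradedPos n)

    s-gradedPos : ∀ n → GradedPos x (2 ℕ.+ n ℕ.* 2) (λ k → s k (1 ℕ.+ n ℕ.* 2))
    s-gradedPos zero = cons {g = λ _ → 0ℚ} 1ℚ (positive⁻¹ 1ℚ) (nil₀ λ _ → refl)
                         (λ k → trans (s-one k) (one-cons (x k)))
    s-gradedPos (suc n) = Step.s-pos (2 ℕ.+ n ℕ.* 2) (graded≤ (2 ℕ.+ n ℕ.* 2)) (α-gradedPos n)

  -- Divisibility by x is not visible in the weight of β; it is read off from β' = x sn α. As sn has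
  -- no constant term, only the tail of sn enters, whose indices are at least two, as `product`
  -- requires.
  β-graded : ∀ m → Σ[ b ∈ (K → ℚ) ] Graded x m b × (∀ k → β k (2 ℕ.+ m) ≡ x k * b k)
  β-graded m = (λ k → r * (tail (s k) *ˢ α k) m)
    , times r (ℚₚ.<⇒≤ (0<1/suc (suc m))) (graded-*ˢ (tail ∘ s) α m λ i i≤m →
        respects (λ k → *-comm (α k (m ∸ i)) (s k (suc i)))
          (reindex (ℕₚ.m∸n+n≡m i≤m) (product i (α-graded (m ∸ i)) (s-graded (suc i)))))
    , λ k → trans (sym (D⇒coeff {β k} (D-β k) (suc m)))
        (trans (cong (λ a → r * (x k * (a * α k (suc m) + (tail (s k) *ˢ α k) m))) (s-zero k))
          (lemma r (x k) (α k (suc m)) _))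
    where
    r = ℤ.+ 1 / suc (suc m)
    lemma : ∀ r x a b → r * (x * (0ℚ * a + b)) ≡ x * (r * b)
    lemma = solve-∀ ℚ-ring

-- Polynomials

infixl 6 _+ᵖ_

_+ᵖ_ : Poly → Poly → Poly
[]      +ᵖ p′       = p′
(q ∷ p) +ᵖ []       = q ∷ p
(q ∷ p) +ᵖ (r ∷ p′) = q + r ∷ p +ᵖ p′

scaleᵖ : ℚ → Poly → Poly
scaleᵖ q = map (q *_)

[1+x]^ : ℕ → Poly
[1+x]^ zero    = 1ℚ ∷ []
[1+x]^ (suc n) = [1+x]^ n +ᵖ (0ℚ ∷ [1+x]^ n)

coeff-+ᵖ : ∀ p p′ → coeff (p +ᵖ p′) ≈ˢ coeff p +ˢ coeff p′
coeff-+ᵖ []      p′       n       = sym (+-identityˡ (coeff p′ n))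
coeff-+ᵖ (q ∷ p) []       n       = sym (+-identityʳ (coeff (q ∷ p) n))
coeff-+ᵖ (q ∷ p) (r ∷ p′) zero    = refl
coeff-+ᵖ (q ∷ p) (r ∷ p′) (suc n) = coeff-+ᵖ p p′ n

eval-+ᵖ : ∀ p p′ x → eval (p +ᵖ p′) x ≡ eval p x + eval p′ x
eval-+ᵖ []      p′       x = sym (+-identityˡ (eval p′ x))
eval-+ᵖ (q ∷ p) []       x = sym (+-identityʳ (eval (q ∷ p) x))
eval-+ᵖ (q ∷ p) (r ∷ p′) x =
  trans (cong (λ a → q + r + x * a) (eval-+ᵖ p p′ x)) (lemma q r x _ _)
  where
  lemma : ∀ q r x a b → q + r + x * (a + b) ≡ (q + x * a) + (r + x * b)
  lemma = solve-∀ ℚ-ring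

coeff-scaleᵖ : ∀ q p → coeff (scaleᵖ q p) ≈ˢ scale q (coeff p)
coeff-scaleᵖ q []      n       = sym (*-zeroʳ q)
coeff-scaleᵖ q (r ∷ p) zero    = refl
coeff-scaleᵖ q (r ∷ p) (suc n) = coeff-scaleᵖ q p n

eval-scaleᵖ : ∀ q p x → eval (scaleᵖ q p) x ≡ q * eval p x
eval-scaleᵖ q []      x = sym (*-zeroʳ q)
eval-scaleᵖ q (r ∷ p) x = trans (cong (λ a → q * r + x * a) (eval-scaleᵖ q p x)) (lemma q r x _)
  where
  lemma : ∀ q r x a → q * r + x * (q * a) ≡ q * (r + x * a)
  lemma = solve-∀ ℚ-ring

coeff-0∷ : ∀ p → coeff (0ℚ ∷ p) ≈ˢ X *ˢ coeff p
coeff-0∷ p zero    = sym (X-*ˢ-zero (coeff p))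
coeff-0∷ p (suc n) = sym (X-*ˢ (coeff p) n)

coeff-[1+x]^ : ∀ n → coeff ([1+x]^ n) ≈ˢ (1ˢ +ˢ X) ^ˢ n
coeff-[1+x]^ zero    zero    = refl
coeff-[1+x]^ zero    (suc i) = refl
coeff-[1+x]^ (suc n) i = begin
  coeff ([1+x]^ n +ᵖ (0ℚ ∷ [1+x]^ n)) i
    ≡⟨ coeff-+ᵖ ([1+x]^ n) (0ℚ ∷ [1+x]^ n) i ⟩
  coeff ([1+x]^ n) i + coeff (0ℚ ∷ [1+x]^ n) i
    ≡⟨ cong₂ _+_ (trans (coeff-[1+x]^ n i) (sym (*ˢ-identityˡ ((1ˢ +ˢ X) ^ˢ n) i)))
         (trans (coeff-0∷ ([1+x]^ n) i) (S.*-congˡ {X} (coeff-[1+x]^ n) i)) ⟩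
  (1ˢ *ˢ (1ˢ +ˢ X) ^ˢ n) i + (X *ˢ (1ˢ +ˢ X) ^ˢ n) i
    ≡⟨ *ˢ-distribʳ ((1ˢ +ˢ X) ^ˢ n) 1ˢ X i ⟨
  ((1ˢ +ˢ X) ^ˢ suc n) i ∎
  where open ≡-Reasoning

coeff-[1+x]^-zero : ∀ n → coeff ([1+x]^ n) 0 ≡ 1ℚ
coeff-[1+x]^-zero zero    = refl
coeff-[1+x]^-zero (suc n) = trans (coeff-+ᵖ ([1+x]^ n) (0ℚ ∷ [1+x]^ n) 0)
  (trans (+-identityʳ _) (coeff-[1+x]^-zero n))

τ^½-even : ∀ d x → τ^½ (d ℕ.* 2) x ≡ (- 1ℚ) ^ d * eval ([1+x]^ d) x
τ^½-even zero    x = lemma x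
  where
  lemma : ∀ x → 1ℚ ≡ 1ℚ * (1ℚ + x * 0ℚ)
  lemma = solve-∀ ℚ-ring
τ^½-even (suc d) x = begin
  τ x * τ^½ (d ℕ.* 2) x
    ≡⟨ cong (τ x *_) (τ^½-even d x) ⟩
  τ x * ((- 1ℚ) ^ d * eval ([1+x]^ d) x)
    ≡⟨ lemma x ((- 1ℚ) ^ d) (eval ([1+x]^ d) x) ⟩
  - 1ℚ * (- 1ℚ) ^ d * (eval ([1+x]^ d) x + (0ℚ + x * eval ([1+x]^ d) x))
    ≡⟨ cong (- 1ℚ * (- 1ℚ) ^ d *_) (eval-+ᵖ ([1+x]^ d) (0ℚ ∷ [1+x]^ d) x) ⟨
  (- 1ℚ) ^ suc d * eval ([1+x]^ (suc d)) x ∎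
  where
  open ≡-Reasoning
  lemma : ∀ x s e → - (1ℚ + x) * (s * e) ≡ - 1ℚ * s * (e + (0ℚ + x * e))
  lemma = solve-∀ ℚ-ring

-- Symmetric coefficient sequences increasing up to the centre

record Palindromic (d : ℕ) (f : Series) : Set where
  field
    nonneg    : ∀ i → 0ℚ ≤ f i
    symmetric : ∀ i j → i ℕ.+ j ≡ d → f i ≡ f j
    vanishing : ∀ i → d ℕ.< i → f i ≡ 0ℚ
    ascending : ∀ i → i ℕ.+ i ℕ.< d → f i ≤ f (suc i)

module _ {d : ℕ} {f : Series} (F : Palindromic d f) where
  open Palindromic F

  palindromic-≈ : ∀ {g} → f ≈ˢ g → Palindromic d g
  palindromic-≈ e = record
    { nonneg    = λ i → subst (0ℚ ≤_) (e i) (nonneg i)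
    ; symmetric = λ i j i+j≡d → trans (sym (e i)) (trans (symmetric i j i+j≡d) (e j))
    ; vanishing = λ i d<i → trans (sym (e i)) (vanishing i d<i)
    ; ascending = λ i 2i<d → subst₂ _≤_ (e i) (e (suc i)) (ascending i 2i<d)
    }

  palindromic-+ˢ : ∀ {g} → Palindromic d g → Palindromic d (f +ˢ g)
  palindromic-+ˢ G = record
    { nonneg    = λ i → +-mono-≤ (nonneg i) (G.nonneg i)
    ; symmetric = λ i j e → cong₂ _+_ (symmetric i j e) (G.symmetric i j e)
    ; vanishing = λ i d<i → cong₂ _+_ (vanishing i d<i) (G.vanishing i d<i)
    ; ascending = λ i 2i<d → +-mono-≤ (ascending i 2i<d) (G.ascending i 2i<d)
    }
    where module G = Palindromic G

  palindromic-scale : ∀ q → 0ℚ ≤ q → Palindromic d (scale q f)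
  palindromic-scale q 0≤q = record
    { nonneg    = λ i → subst (_≤ q * f i) (*-zeroʳ q) (mono (nonneg i))
    ; symmetric = λ i j e → cong (q *_) (symmetric i j e)
    ; vanishing = λ i d<i → trans (cong (q *_) (vanishing i d<i)) (*-zeroʳ q)
    ; ascending = λ i 2i<d → mono (ascending i 2i<d)
    }
    where
    mono : ∀ {a b} → a ≤ b → q * a ≤ q * b
    mono = *-monoˡ-≤-nonNeg q {{nonNegative 0≤q}}

  private
    shift : Series
    shift zero    = 0ℚ
    shift (suc i) = f i

    shift≈ : shift ≈ˢ X *ˢ f
    shift≈ zero    = sym (X-*ˢ-zero f)
    shift≈ (suc i) = sym (X-*ˢ f i)

    double-suc : ∀ {i n} → suc i ℕ.+ suc i ℕ.< 2 ℕ.+ n → i ℕ.+ i ℕ.< n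
    double-suc {i} {n} 2+2i<2+n = ℕₚ.≤-pred (subst (ℕ._≤ suc n) (cong suc (ℕₚ.+-suc i i)) (ℕₚ.≤-pred 2+2i<2+n))

  palindromic-X* : Palindromic (2 ℕ.+ d) (X *ˢ f)
  palindromic-X* = record
    { nonneg    = λ i → subst (0ℚ ≤_) (shift≈ i) (shift-nonneg i)
    ; symmetric = λ i j e → trans (sym (shift≈ i)) (trans (shift-symmetric i j e) (shift≈ j))
    ; vanishing = λ i d<i → trans (sym (shift≈ i)) (shift-vanishing i d<i)
    ; ascending = λ i 2i<d → subst₂ _≤_ (shift≈ i) (shift≈ (suc i)) (shift-ascending i 2i<d)
    }
    where
    shift-nonneg : ∀ i → 0ℚ ≤ shift i
    shift-nonneg zero    = ≤-refl
    shift-nonneg (suc i) = nonneg i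
    shift-symmetric : ∀ i j → i ℕ.+ j ≡ 2 ℕ.+ d → shift i ≡ shift j
    shift-symmetric zero    .(2 ℕ.+ d) refl = sym (vanishing (suc d) ℕₚ.≤-refl)
    shift-symmetric (suc i) zero    e = vanishing i
      (ℕₚ.≤-reflexive (sym (trans (sym (ℕₚ.+-identityʳ i)) (ℕₚ.suc-injective e))))
    shift-symmetric (suc i) (suc j) e = symmetric i j
      (ℕₚ.suc-injective (trans (sym (ℕₚ.+-suc i j)) (ℕₚ.suc-injective e)))
    shift-vanishing : ∀ i → 2 ℕ.+ d ℕ.< i → shift i ≡ 0ℚ
    shift-vanishing (suc i) (s≤s 2+d≤i) = vanishing i (ℕₚ.<-trans ℕₚ.≤-refl 2+d≤i)
    shift-ascending : ∀ i → i ℕ.+ i ℕ.< 2 ℕ.+ d → shift i ≤ shift (suc i)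
    shift-ascending zero    _    = nonneg 0
    shift-ascending (suc i) 2i<d = ascending i (double-suc 2i<d)

  palindromic-[1+X]* : Palindromic (suc d) ((1ˢ +ˢ X) *ˢ f)
  palindromic-[1+X]* = record
    { nonneg    = λ i → subst (0ℚ ≤_) (spread≈ i) (spread-nonneg i)
    ; symmetric = λ i j e → trans (sym (spread≈ i)) (trans (spread-symmetric i j e) (spread≈ j))
    ; vanishing = λ i d<i → trans (sym (spread≈ i)) (spread-vanishing i d<i)
    ; ascending = λ i 2i<d → subst₂ _≤_ (spread≈ i) (spread≈ (suc i)) (spread-ascending i 2i<d)
    }
    where
    spread : Series
    spread i = f i + shift i
    spread≈ : spread ≈ˢ (1ˢ +ˢ X) *ˢ f
    spread≈ i = sym (trans (*ˢ-distribʳ f 1ˢ X i)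
      (cong₂ _+_ (*ˢ-identityˡ f i) (sym (shift≈ i))))
    spread-nonneg : ∀ i → 0ℚ ≤ spread i
    spread-nonneg zero    = +-mono-≤ (nonneg 0) ≤-refl
    spread-nonneg (suc i) = +-mono-≤ (nonneg (suc i)) (nonneg i)
    end : f 0 + 0ℚ ≡ f (suc d) + f d
    end = trans (+-comm (f 0) 0ℚ)
      (cong₂ _+_ (sym (vanishing (suc d) ℕₚ.≤-refl)) (symmetric 0 d refl))
    spread-symmetric : ∀ i j → i ℕ.+ j ≡ suc d → spread i ≡ spread j
    spread-symmetric zero    .(suc d) refl = end
    spread-symmetric (suc i) zero     e with trans (sym (ℕₚ.+-identityʳ i)) (ℕₚ.suc-injective e)
    ... | refl = sym end
    spread-symmetric (suc i) (suc j)  e = trans (+-comm (f (suc i)) (f i))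
      (cong₂ _+_ (symmetric i (suc j) (ℕₚ.suc-injective e))
                 (symmetric (suc i) j (trans (sym (ℕₚ.+-suc i j)) (ℕₚ.suc-injective e))))
    spread-vanishing : ∀ i → suc d ℕ.< i → spread i ≡ 0ℚ
    spread-vanishing (suc i) (s≤s d<i) = cong₂ _+_ (vanishing (suc i) (ℕₚ.m<n⇒m<1+n d<i)) (vanishing i d<i)
    ascending² : ∀ i → suc i ℕ.+ suc i ℕ.≤ d → f i ≤ f (suc (suc i))
    ascending² i 2+2i≤d with ℕₚ.m≤n⇒m<n∨m≡n 2+2i≤d
    ... | inj₁ 2+2i<d = ≤-trans
      (ascending i (ℕₚ.<-trans (ℕₚ.+-mono-< (ℕₚ.n<1+n i) (ℕₚ.n<1+n i)) 2+2i<d))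
      (ascending (suc i) 2+2i<d)
    ... | inj₂ 2+2i≡d = ≤-reflexive (symmetric i (suc (suc i)) (trans (ℕₚ.+-suc i (suc i)) 2+2i≡d))
    spread-ascending : ∀ i → i ℕ.+ i ℕ.< suc d → spread i ≤ spread (suc i)
    spread-ascending zero    _ = subst (_≤ f 1 + f 0) (+-comm 0ℚ (f 0)) (+-monoˡ-≤ (f 0) (nonneg 1))
    spread-ascending (suc i) 2+2i<1+d = subst (_≤ f (suc (suc i)) + f (suc i))
      (+-comm (f i) (f (suc i))) (+-monoˡ-≤ (f (suc i)) (ascending² i (ℕₚ.≤-pred 2+2i<1+d)))

palindromic-[1+X]^ : ∀ n → Palindromic n ((1ˢ +ˢ X) ^ˢ n)
palindromic-[1+X]^ zero = record
  { nonneg    = λ { zero → ℚₚ.<⇒≤ (positive⁻¹ 1ℚ) ; (suc i) → ≤-refl }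
  ; symmetric = λ { zero zero e → refl }
  ; vanishing = λ { (suc i) _ → refl }
  ; ascending = λ i ()
  }
palindromic-[1+X]^ (suc n) = palindromic-[1+X]* (palindromic-[1+X]^ n)

palindromic⇒symmetric : ∀ {d p} → Palindromic d (coeff p) → Symmetric (ℤ.+ d) p
palindromic⇒symmetric {d} {p} P (ℤ.+ i) with i ℕₚ.≤? d
... | yes i≤d = trans (symmetric i (d ∸ i) (ℕₚ.m+[n∸m]≡n i≤d))
        (cong (coeffℤ p) (sym (trans (ℤₚ.[+m]-[+n]≡m⊖n d i) (ℤₚ.⊖-≥ i≤d))))
  where open Palindromic P
... | no  i≰d = trans (vanishing i d<i)
        (cong (coeffℤ p) (sym (trans (ℤₚ.[+m]-[+n]≡m⊖n d i) (trans (ℤₚ.⊖-< d<i) (-suc (ℕₚ.m<n⇒0<n∸m d<i))))))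
  where
  open Palindromic P
  d<i = ℕₚ.≰⇒> i≰d
  -suc : ∀ {m} → 0 ℕ.< m → ℤ.- (ℤ.+ m) ≡ ℤ.-[1+ m ∸ 1 ]
  -suc (s≤s _) = refl
palindromic⇒symmetric {d} P ℤ.-[1+ i ] =
  sym (Palindromic.vanishing P (d ℕ.+ suc i) (ℕₚ.m<m+n d (s≤s z≤n)))

-- γ-vectors of graded functions

-- The summand k = 0 is split off and one X is taken out of the others, since (2 + d) - 2(k + 1) = d
-- - 2k. This is the same recursion as in `Graded`, with `γ zero` in the role of q.
γ-expansion-suc : ∀ d γ → γ-expansion (2 ℕ.+ d) γ ≈ˢ
                  scale (γ zero) ((1ˢ +ˢ X) ^ˢ (2 ℕ.+ d)) +ˢ X *ˢ γ-expansion d (γ ∘ suc)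
γ-expansion-suc d γ i = cong₂ _+_
  (cong (γ zero *_) (*ˢ-identityˡ ((1ˢ +ˢ X) ^ˢ (2 ℕ.+ d)) i))
  (sym (trans (*ˢ-sum X (λ k → scale (γ (suc k)) (term k)) i)
    (sum-cong-≗ λ k → trans (*ˢ-scale (γ (suc k)) X (term k) i)
      (cong (γ (suc k) *_) (trans
        (sym (*ˢ-assoc X (X ^ˢ toℕ k) ((1ˢ +ˢ X) ^ˢ (d ∸ 2 ℕ.* toℕ k)) i))
        (cong (λ m → (X ^ˢ suc (toℕ k) *ˢ (1ˢ +ˢ X) ^ˢ (suc d ∸ m)) i)
          (sym (ℕₚ.+-suc (toℕ k) (toℕ k ℕ.+ 0)))))))))
  where
  term : Fin (suc ⌊ d /2⌋) → Series
  term k = X ^ˢ toℕ k *ˢ (1ˢ +ˢ X) ^ˢ (d ∸ 2 ℕ.* toℕ k)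

-- The rise of the coefficients towards the centre is recorded next to the γ-vector, both being
-- built in one recursion; the inequalities for J_{2n} come from this rise.
record IsγPoly (d : ℕ) (p : Poly) : Set where
  field
    palindromic : Palindromic d (coeff p)
    nonnegative : HasNonnegativeγ (ℤ.+ d) p

  γ-positive : γ-Positive (ℤ.+ d) p
  γ-positive = palindromic⇒symmetric palindromic , nonnegative

coeff-q[1+x]^ : ∀ d q → coeff (scaleᵖ q ([1+x]^ d)) ≈ˢ scale q ((1ˢ +ˢ X) ^ˢ d)
coeff-q[1+x]^ d q i = trans (coeff-scaleᵖ q ([1+x]^ d) i) (cong (q *_) (coeff-[1+x]^ d i))

palindromic-q[1+x]^ : ∀ d q → 0ℚ ≤ q → Palindromic d (coeff (scaleᵖ q ([1+x]^ d)))
palindromic-q[1+x]^ d q 0≤q =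
  palindromic-≈ (palindromic-scale (palindromic-[1+X]^ d) q 0≤q) (≈ˢ-sym (coeff-q[1+x]^ d q))

eval-q[1+x]^ : ∀ d q x {a b} → a ≡ q * τ^½ (d ℕ.* 2) x + x * b → b ≡ 0ℚ →
               a ≡ (- 1ℚ) ^ d * eval (scaleᵖ q ([1+x]^ d)) x
eval-q[1+x]^ d q x refl refl = trans
  (cong (λ t → q * t + x * 0ℚ) (τ^½-even d x))
  (trans (lemma q ((- 1ℚ) ^ d) (eval ([1+x]^ d) x) x)
    (cong ((- 1ℚ) ^ d *_) (sym (eval-scaleᵖ q ([1+x]^ d) x))))
  where
  lemma : ∀ q s e x → q * (s * e) + x * 0ℚ ≡ s * (q * e)
  lemma = solve-∀ ℚ-ring

module _ {K : Set} {x : K → ℚ} where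

  -- The constant q is γ_0, and g supplies the remaining γ in degree d - 2. A factor x lowers the
  -- degree by two, so the sign (-1)^d is common to all summands and factors out. For d < 2 the
  -- index forces g = 0.
  cons⇒γPoly : ∀ d {f g : K → ℚ} q → 0ℚ ≤ q → Graded x (d ℕ.* 2 ∸ 2) g →
    (∀ k → f k ≡ q * τ^½ (d ℕ.* 2) (x k) + x k * g k) →
    Σ[ p ∈ Poly ] IsγPoly d p × coeff p 0 ≡ q × (∀ k → f k ≡ (- 1ℚ) ^ d * eval p (x k))
  cons⇒γPoly 0 {f} {g} q 0≤q (nil₀ z) e = scaleᵖ q ([1+x]^ 0) , record
    { palindromic = palindromic-q[1+x]^ 0 q 0≤q
    ; nonnegative = (λ _ → q)
        , (λ i → trans (coeff-q[1+x]^ 0 q i) (sym (trans (+-identityʳ _) (cong (q *_) (*ˢ-identityˡ 1ˢ i)))))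
        , λ _ → 0≤q
    } , *-identityʳ q , λ k → eval-q[1+x]^ 0 q (x k) (e k) (z k)
  cons⇒γPoly 1 {f} {g} q 0≤q (nil₀ z) e = scaleᵖ q ([1+x]^ 1) , record
    { palindromic = palindromic-q[1+x]^ 1 q 0≤q
    ; nonnegative = (λ _ → q)
        , (λ i → trans (coeff-q[1+x]^ 1 q i)
            (sym (trans (+-identityʳ _) (cong (q *_) (*ˢ-identityˡ ((1ˢ +ˢ X) ^ˢ 1) i)))))
        , λ _ → 0≤q
    } , *-identityʳ q , λ k → eval-q[1+x]^ 1 q (x k) (e k) (z k)
  cons⇒γPoly (suc (suc d)) {f} {g} q 0≤q (cons q′ 0≤q′ p z) e
    with cons⇒γPoly d q′ 0≤q′ p z
  ... | p′ , p′-γ , _ , g≡ = scaleᵖ q ([1+x]^ (2 ℕ.+ d)) +ᵖ (0ℚ ∷ p′) , record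
    { palindromic = palindromic-≈
        (palindromic-+ˢ (palindromic-q[1+x]^ (2 ℕ.+ d) q 0≤q)
          (palindromic-≈ (palindromic-X* palindromic) (≈ˢ-sym (coeff-0∷ p′))))
        (≈ˢ-sym (coeff-+ᵖ (scaleᵖ q ([1+x]^ (2 ℕ.+ d))) (0ℚ ∷ p′)))
    ; nonnegative = γ
        , (λ i → begin
            coeff (scaleᵖ q ([1+x]^ (2 ℕ.+ d)) +ᵖ (0ℚ ∷ p′)) i
              ≡⟨ coeff-+ᵖ (scaleᵖ q ([1+x]^ (2 ℕ.+ d))) (0ℚ ∷ p′) i ⟩
            coeff (scaleᵖ q ([1+x]^ (2 ℕ.+ d))) i + coeff (0ℚ ∷ p′) i
              ≡⟨ cong₂ _+_ (coeff-q[1+x]^ (2 ℕ.+ d) q i)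
                   (trans (coeff-0∷ p′ i) (S.*-congˡ {X} (proj₁ (proj₂ nonnegative)) i)) ⟩
            q * ((1ˢ +ˢ X) ^ˢ (2 ℕ.+ d)) i + (X *ˢ γ-expansion d γ′) i
              ≡⟨ γ-expansion-suc d γ i ⟨
            γ-expansion (2 ℕ.+ d) γ i ∎)
        , λ { zero → 0≤q ; (suc k) → proj₂ (proj₂ nonnegative) k }
    }
    , (begin
        coeff (scaleᵖ q ([1+x]^ (2 ℕ.+ d)) +ᵖ (0ℚ ∷ p′)) 0
          ≡⟨ coeff-+ᵖ (scaleᵖ q ([1+x]^ (2 ℕ.+ d))) (0ℚ ∷ p′) 0 ⟩
        coeff (scaleᵖ q ([1+x]^ (2 ℕ.+ d))) 0 + 0ℚ
          ≡⟨ +-identityʳ _ ⟩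
        coeff (scaleᵖ q ([1+x]^ (2 ℕ.+ d))) 0
          ≡⟨ coeff-scaleᵖ q ([1+x]^ (2 ℕ.+ d)) 0 ⟩
        q * coeff ([1+x]^ (2 ℕ.+ d)) 0
          ≡⟨ cong (q *_) (coeff-[1+x]^-zero (2 ℕ.+ d)) ⟩
        q * 1ℚ
          ≡⟨ *-identityʳ q ⟩
        q ∎)
    , λ k → begin
        f k
          ≡⟨ e k ⟩
        q * τ^½ ((2 ℕ.+ d) ℕ.* 2) (x k) + x k * g k
          ≡⟨ cong₂ (λ a b → q * a + x k * b) (τ^½-even (2 ℕ.+ d) (x k)) (g≡ k) ⟩
        q * ((- 1ℚ) ^ (2 ℕ.+ d) * eval ([1+x]^ (2 ℕ.+ d)) (x k)) + x k * ((- 1ℚ) ^ d * eval p′ (x k))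
          ≡⟨ lemma q ((- 1ℚ) ^ d) _ (x k) (eval p′ (x k)) ⟩
        (- 1ℚ) ^ (2 ℕ.+ d) * (q * eval ([1+x]^ (2 ℕ.+ d)) (x k) + (0ℚ + x k * eval p′ (x k)))
          ≡⟨ cong (λ a → (- 1ℚ) ^ (2 ℕ.+ d) * (a + (0ℚ + x k * eval p′ (x k))))
               (eval-scaleᵖ q ([1+x]^ (2 ℕ.+ d)) (x k)) ⟨
        (- 1ℚ) ^ (2 ℕ.+ d) * (eval (scaleᵖ q ([1+x]^ (2 ℕ.+ d))) (x k) + eval (0ℚ ∷ p′) (x k))
          ≡⟨ cong ((- 1ℚ) ^ (2 ℕ.+ d) *_) (eval-+ᵖ (scaleᵖ q ([1+x]^ (2 ℕ.+ d))) (0ℚ ∷ p′) (x k)) ⟨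
        (- 1ℚ) ^ (2 ℕ.+ d) * eval (scaleᵖ q ([1+x]^ (2 ℕ.+ d)) +ᵖ (0ℚ ∷ p′)) (x k) ∎
    where
    open ≡-Reasoning
    open IsγPoly p′-γ
    γ′ = proj₁ nonnegative
    γ : Vector ℚ (2 ℕ.+ ⌊ d /2⌋)
    γ zero    = q
    γ (suc k) = γ′ k
    lemma : ∀ q s a x b → q * (- 1ℚ * (- 1ℚ * s) * a) + x * (s * b) ≡
                          - 1ℚ * (- 1ℚ * s) * (q * a + (0ℚ + x * b))
    lemma = solve-∀ ℚ-ring

  graded⇒γPoly : ∀ d {f : K → ℚ} → Graded x (2 ℕ.+ d ℕ.* 2) f →
    Σ[ p ∈ Poly ] IsγPoly d p × (∀ k → f k ≡ (- 1ℚ) ^ d * eval p (x k))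
  graded⇒γPoly d (cons q 0≤q g e) with cons⇒γPoly d q 0≤q g e
  ... | p , p-γ , _ , f≡ = p , p-γ , f≡

  gradedPos⇒γPoly : ∀ d {f : K → ℚ} → GradedPos x (2 ℕ.+ d ℕ.* 2) f →
    Σ[ p ∈ Poly ] IsγPoly d p × 0ℚ < coeff p 0 × (∀ k → f k ≡ (- 1ℚ) ^ d * eval p (x k))
  gradedPos⇒γPoly d (cons q 0<q g e) with cons⇒γPoly d q (ℚₚ.<⇒≤ 0<q) g e
  ... | p , p-γ , p₀ , f≡ = p , p-γ , subst (0ℚ <_) (sym p₀) 0<q , f≡

-- A polynomial is determined by its values at the points k², 0 < k < 1

norm : Poly → ℚ
norm []      = 0ℚ
norm (q ∷ p) = ∣ q ∣ + norm p

0≤norm : ∀ p → 0ℚ ≤ norm p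
0≤norm []      = ≤-refl
0≤norm (q ∷ p) = +-mono-≤ (0≤∣p∣ q) (0≤norm p)

∣*eval∣ : ∀ p {x} → 0ℚ ≤ x → ∣ x * eval p x ∣ ≡ x * ∣ eval p x ∣
∣*eval∣ p {x} 0≤x = trans (∣p*q∣≡∣p∣*∣q∣ x (eval p x)) (cong (_* ∣ eval p x ∣) (0≤p⇒∣p∣≡p 0≤x))

∣eval∣≤norm : ∀ p {x} → 0ℚ ≤ x → x ≤ 1ℚ → ∣ eval p x ∣ ≤ norm p
∣eval∣≤norm []      0≤x x≤1 = ≤-refl
∣eval∣≤norm (q ∷ p) {x} 0≤x x≤1 = begin
  ∣ q + x * eval p x ∣          ≤⟨ ∣p+q∣≤∣p∣+∣q∣ q (x * eval p x) ⟩
  ∣ q ∣ + ∣ x * eval p x ∣      ≡⟨ cong (∣ q ∣ +_) (∣*eval∣ p 0≤x) ⟩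
  ∣ q ∣ + x * ∣ eval p x ∣      ≤⟨ +-monoʳ-≤ ∣ q ∣ (*-monoʳ-≤-nonNeg ∣ eval p x ∣ {{∣-∣-nonNeg (eval p x)}} x≤1) ⟩
  ∣ q ∣ + 1ℚ * ∣ eval p x ∣     ≡⟨ cong (∣ q ∣ +_) (*-identityˡ ∣ eval p x ∣) ⟩
  ∣ q ∣ + ∣ eval p x ∣          ≤⟨ +-monoʳ-≤ ∣ q ∣ (∣eval∣≤norm p 0≤x x≤1) ⟩
  ∣ q ∣ + norm p                ∎
  where open ℚₚ.≤-Reasoning

0<^2 : ∀ {k} → 0ℚ < k → 0ℚ < k ^ 2
0<^2 {k} 0<k = subst (0ℚ <_) (cong (k *_) (sym (*-identityʳ k)))
  (positive⁻¹ (k * k) {{pos*pos⇒pos k {{positive 0<k}} k {{positive 0<k}}}})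

^2≤ : ∀ {k} → 0ℚ < k → k < 1ℚ → k ^ 2 ≤ k
^2≤ {k} 0<k k<1 = subst₂ _≤_ (cong (k *_) (sym (*-identityʳ k))) (*-identityʳ k)
  (*-monoˡ-≤-nonNeg k {{nonNegative (ℚₚ.<⇒≤ 0<k)}} (ℚₚ.<⇒≤ k<1))

small : ∀ {a M} → 0ℚ < a → 0ℚ ≤ M → ∃[ k ] 0ℚ < k × k < 1ℚ × k * M < a
-- The witness is k = a/(a + M + 1): both a and M lie below the denominator, which gives k < 1 and k
-- M < a.
small {a} {M} 0<a 0≤M = a * r , 0<k , k<1 , kM<a
  where
  t = a + (M + 1ℚ)
  M<M+1 : M < M + 1ℚ
  M<M+1 = subst (_< M + 1ℚ) (+-identityʳ M) (+-monoʳ-< M (positive⁻¹ 1ℚ))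
  a<t : a < t
  a<t = subst (_< t) (+-identityʳ a) (+-monoʳ-< a (≤-<-trans 0≤M M<M+1))
  M<t : M < t
  M<t = <-trans M<M+1 (subst (_< t) (+-identityˡ (M + 1ℚ)) (+-monoˡ-< (M + 1ℚ) 0<a))
  instance
    a⁺ : Positive a
    a⁺ = positive 0<a
    t⁺ : Positive t
    t⁺ = positive (<-trans 0<a a<t)
    t≢0 : NonZero t
    t≢0 = pos⇒nonZero t
  r = 1/ t
  instance
    r⁺ : Positive r
    r⁺ = 1/pos⇒pos t
  0<k : 0ℚ < a * r
  0<k = positive⁻¹ (a * r) {{pos*pos⇒pos a r}}
  k<1 : a * r < 1ℚ
  k<1 = subst (a * r <_) (*-inverseʳ t) (*-monoˡ-<-pos r a<t)
  kM<a : a * r * M < a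
  kM<a = subst₂ _<_ (sym (*-assoc a r M)) (*-identityʳ a)
    (*-monoʳ-<-pos a (subst (r * M <_) (*-inverseˡ t) (*-monoʳ-<-pos r M<t)))

-- If q were nonzero, some k would be so small that x p(x), bounded by k · `norm p`, could not
-- cancel it.
vanishing-head : ∀ q p → (∀ k → 0ℚ < k → k < 1ℚ → eval (q ∷ p) (k ^ 2) ≡ 0ℚ) → q ≡ 0ℚ
vanishing-head q p e with q ≟ 0ℚ
... | yes q≡0 = q≡0
... | no  q≢0 with small {∣ q ∣} {norm p} (≢0⇒0<∣∣ q≢0) (0≤norm p)
  where
  ≢0⇒0<∣∣ : q ≢ 0ℚ → 0ℚ < ∣ q ∣
  ≢0⇒0<∣∣ q≢0 = positive⁻¹ ∣ q ∣ {{nonNeg∧nonZero⇒pos ∣ q ∣ {{∣-∣-nonNeg q}}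
    {{≢-nonZero {∣ q ∣} (λ ∣q∣≡0 → q≢0 (∣p∣≡0⇒p≡0 q ∣q∣≡0))}}}}
... | k , 0<k , k<1 , kM<∣q∣ = contradiction (begin-strict
  ∣ q ∣                        ≡⟨ ∣-p∣≡∣p∣ q ⟨
  ∣ - q ∣                      ≡⟨ cong ∣_∣ (trans (sym (+-identityʳ (- q)))
                                    (trans (cong (- q +_) (sym (e k 0<k k<1))) (cancel q (x * eval p x)))) ⟩
  ∣ x * eval p x ∣             ≡⟨ ∣*eval∣ p 0≤x ⟩
  x * ∣ eval p x ∣             ≤⟨ *-monoˡ-≤-nonNeg x {{nonNegative 0≤x}}
                                    (∣eval∣≤norm p 0≤x (≤-trans (^2≤ 0<k k<1) (ℚₚ.<⇒≤ k<1))) ⟩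
  x * norm p                   ≤⟨ *-monoʳ-≤-nonNeg (norm p) {{nonNegative (0≤norm p)}} (^2≤ 0<k k<1) ⟩
  k * norm p                   <⟨ kM<∣q∣ ⟩
  ∣ q ∣                        ∎) (<-irrefl refl)
  where
  open ℚₚ.≤-Reasoning
  x = k ^ 2
  0≤x = ℚₚ.<⇒≤ (0<^2 0<k)
  cancel : ∀ q a → - q + (q + a) ≡ a
  cancel = solve-∀ ℚ-ring

vanishing : ∀ p → (∀ k → 0ℚ < k → k < 1ℚ → eval p (k ^ 2) ≡ 0ℚ) → coeff p ≈ˢ 0ˢ
vanishing []      e i       = refl
vanishing (q ∷ p) e zero    = vanishing-head q p e
vanishing (q ∷ p) e (suc i) = vanishing p lower i
  where
  lower : ∀ k → 0ℚ < k → k < 1ℚ → eval p (k ^ 2) ≡ 0ℚ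
  lower k 0<k k<1 = begin
    eval p x                        ≡⟨ *-identityˡ (eval p x) ⟨
    1ℚ * eval p x                   ≡⟨ cong (_* eval p x) (*-inverseˡ x) ⟨
    1/ x * x * eval p x             ≡⟨ *-assoc (1/ x) x (eval p x) ⟩
    1/ x * (x * eval p x)           ≡⟨ cong (1/ x *_) (+-identityˡ (x * eval p x)) ⟨
    1/ x * (0ℚ + x * eval p x)      ≡⟨ cong (λ a → 1/ x * (a + x * eval p x)) (vanishing-head q p e) ⟨
    1/ x * (q + x * eval p x)       ≡⟨ cong (1/ x *_) (e k 0<k k<1) ⟩
    1/ x * 0ℚ                       ≡⟨ *-zeroʳ (1/ x) ⟩
    0ℚ                              ∎
    where
    open ≡-Reasoning
    x = k ^ 2
    instance
      x≢0 : NonZero x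
      x≢0 = pos⇒nonZero x {{positive (0<^2 0<k)}}

eval-injective : ∀ p r → (∀ k → 0ℚ < k → k < 1ℚ → eval p (k ^ 2) ≡ eval r (k ^ 2)) → coeff p ≈ˢ coeff r
eval-injective p r e i = begin
  coeff p i                                    ≡⟨ lemma₂ (coeff p i) (coeff r i) ⟩
  coeff p i + - 1ℚ * coeff r i + coeff r i     ≡⟨ cong (_+ coeff r i) difference ⟩
  0ℚ + coeff r i                               ≡⟨ +-identityˡ (coeff r i) ⟩
  coeff r i                                    ∎
  where
  open ≡-Reasoning
  lemma₁ : ∀ a → a + - 1ℚ * a ≡ 0ℚ
  lemma₁ = solve-∀ ℚ-ring
  lemma₂ : ∀ a b → a ≡ a + - 1ℚ * b + b
  lemma₂ = solve-∀ ℚ-ring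
  difference : coeff p i + - 1ℚ * coeff r i ≡ 0ℚ
  difference = trans
    (sym (trans (coeff-+ᵖ p (scaleᵖ (- 1ℚ) r) i) (cong (coeff p i +_) (coeff-scaleᵖ (- 1ℚ) r i))))
    (vanishing (p +ᵖ scaleᵖ (- 1ℚ) r) (λ k 0<k k<1 →
      trans (eval-+ᵖ p (scaleᵖ (- 1ℚ) r) (k ^ 2))
        (trans (cong₂ _+_ (e k 0<k k<1) (eval-scaleᵖ (- 1ℚ) r (k ^ 2))) (lemma₁ (eval r (k ^ 2))))) i)

-- Consequences of a γ-positive decomposition

-- γ-positivity in degree n - 1, where degree -1 leaves only the zero polynomial.
IsγPoly⁻ : ℕ → Poly → Set
IsγPoly⁻ zero    p = p ≡ []
IsγPoly⁻ (suc n) p = IsγPoly n p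

γPoly⁻-positive : ∀ n {p} → IsγPoly⁻ n p → γ-Positive (ℤ.+ n ℤ.- ℤ.+ 1) p
γPoly⁻-positive zero    refl = (λ i → trans (zeroℤ i) (sym (zeroℤ (ℤ.-[1+ 0 ] ℤ.- i))))
                             , λ { zero → refl ; (suc i) → refl }
  where
  zeroℤ : ∀ i → coeffℤ [] i ≡ 0ℚ
  zeroℤ (ℤ.+ i)    = refl
  zeroℤ ℤ.-[1+ i ] = refl
γPoly⁻-positive (suc n) p-γ = IsγPoly.γ-positive p-γ

-- Multiplication by X moves the degree from n - 1 to n + 1, so the exceptional degree -1 disappears
-- from the inequalities below.
γPoly⁻-palindromic : ∀ n {p} → IsγPoly⁻ n p → Palindromic (suc n) (X *ˢ coeff p)
γPoly⁻-palindromic zero refl = palindromic-≈ zero-palindromic (≈ˢ-sym (S.zeroʳ X))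
  where
  zero-palindromic : ∀ {d} → Palindromic d 0ˢ
  zero-palindromic = record
    { nonneg    = λ _ → ≤-refl
    ; symmetric = λ _ _ _ → refl
    ; vanishing = λ _ _ → refl
    ; ascending = λ _ _ → ≤-refl
    }
γPoly⁻-palindromic (suc n) p-γ = palindromic-X* (IsγPoly.palindromic p-γ)

module Decomposed
  (n : ℕ) (f a b : Poly)
  (a-γ : IsγPoly n a) (0<a₀ : 0ℚ < coeff a 0) (b-γ : IsγPoly⁻ n b)
  (f≈ : coeff f ≈ˢ coeff a +ˢ X *ˢ coeff b) where

  private
    module A = Palindromic (IsγPoly.palindromic a-γ)
    module B = Palindromic (γPoly⁻-palindromic n b-γ)

  -- The coefficient at n is a_n = a_0 > 0 plus a nonnegative term. At n + 1 the summand X b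
  -- contributes the mirror image of its constant term, which is 0.
  hasDegree : HasDegree f n
  hasDegree = (λ fₙ≡0 → <⇒≢ 0<fₙ (trans (sym fₙ≡0) (f≈ n))) , λ i n<i →
    trans (f≈ i) (cong₂ _+_ (A.vanishing i n<i) (Xb-vanishing i n<i))
    where
    0<fₙ : 0ℚ < coeff a n + (X *ˢ coeff b) n
    0<fₙ = +-mono-<-≤ (subst (0ℚ <_) (A.symmetric 0 n refl) 0<a₀) (B.nonneg n)
    Xb-vanishing : ∀ i → n ℕ.< i → (X *ˢ coeff b) i ≡ 0ℚ
    Xb-vanishing i n<i with ℕₚ.m≤n⇒m<n∨m≡n n<i
    ... | inj₁ 1+n<i = B.vanishing i 1+n<i
    ... | inj₂ refl  = trans (sym (B.symmetric 0 (suc n) refl)) (X-*ˢ-zero (coeff b))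

  bi-γ-positive : Bi-γ-Positive f
  bi-γ-positive = n , hasDegree , a , b
    , (f≈ , proj₁ a-γ-positive , proj₁ b-γ-positive) , a-γ-positive , b-γ-positive
    where
    a-γ-positive = IsγPoly.γ-positive a-γ
    b-γ-positive = γPoly⁻-positive n b-γ

  -- Here a takes equal values at i and j, while X b rises from i to i + 1, the mirror image of j
  -- about (n + 1)/2.
  low≤high : ∀ i j → i ℕ.+ j ≡ n → i ℕ.+ i ℕ.< n → coeff f i ≤ coeff f j
  low≤high i j i+j≡n 2i<n = subst₂ _≤_ (sym (f≈ i)) (sym (f≈ j))
    (+-mono-≤ (≤-reflexive (A.symmetric i j i+j≡n))
      (≤-trans (B.ascending i (ℕₚ.m<n⇒m<1+n 2i<n)) (≤-reflexive (B.symmetric (suc i) j (cong suc i+j≡n)))))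

  -- The roles are exchanged: X b takes equal values at j and i + 1, while a rises from i, the
  -- mirror image of j about n/2, to i + 1.
  high≤low : ∀ i j → i ℕ.+ j ≡ n → suc (i ℕ.+ i) ℕ.< n → coeff f j ≤ coeff f (suc i)
  high≤low i j i+j≡n 1+2i<n = subst₂ _≤_ (sym (f≈ j)) (sym (f≈ (suc i)))
    (+-mono-≤
      (≤-trans (≤-reflexive (sym (A.symmetric i j i+j≡n))) (A.ascending i (ℕₚ.<-trans (ℕₚ.n<1+n (i ℕ.+ i)) 1+2i<n)))
      (≤-reflexive (sym (B.symmetric (suc i) j (cong suc i+j≡n)))))

  private
    2*≡ : ∀ i → 2 ℕ.* i ≡ i ℕ.+ i
    2*≡ i = cong (i ℕ.+_) (ℕₚ.+-identityʳ i)

    i≤n : ∀ i → i ℕ.+ i ℕ.< n → i ℕ.≤ n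
    i≤n i 2i<n = ℕₚ.≤-trans (ℕₚ.m≤m+n i i) (ℕₚ.<⇒≤ 2i<n)

  alternatinglyIncreasing : AlternatinglyIncreasing f
  alternatinglyIncreasing = n , hasDegree
    , (λ i 2i<n → let 2i<n′ = subst (ℕ._< n) (2*≡ i) 2i<n in
        low≤high i (n ∸ i) (ℕₚ.m+[n∸m]≡n (i≤n i 2i<n′)) 2i<n′)
    , (λ i 1+2i<n → let 1+2i<n′ = subst (λ m → suc m ℕ.< n) (2*≡ i) 1+2i<n in
        high≤low i (n ∸ i) (ℕₚ.m+[n∸m]≡n (i≤n i (ℕₚ.<-trans (ℕₚ.n<1+n (i ℕ.+ i)) 1+2i<n′))) 1+2i<n′)

  rising : ∀ i → i ℕ.+ i ℕ.< n → coeff f i ≤ coeff f (suc i)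
  rising i 2i<n with ℕₚ.m≤n⇒m<n∨m≡n 2i<n
  ... | inj₁ 1+2i<n = ≤-trans (low≤high i (n ∸ i) i+j≡n 2i<n) (high≤low i (n ∸ i) i+j≡n 1+2i<n)
    where i+j≡n = ℕₚ.m+[n∸m]≡n (i≤n i 2i<n)
  ... | inj₂ 1+2i≡n = low≤high i (suc i) (trans (ℕₚ.+-suc i i) 1+2i≡n) 2i<n

  -- The comparison passes through the coefficient at j + 1 = n - i, which lies between the two; at
  -- the centre it coincides with the one at i.
  falling : ∀ j i → suc j ℕ.+ i ≡ n → suc j ℕ.+ suc j ℕ.≤ n → coeff f (suc i) ≤ coeff f i
  falling j i j+i≡n 2+2j≤n = ≤-trans
    (high≤low j (suc i) (trans (ℕₚ.+-suc j i) j+i≡n) 1+2j<n)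
    (middle (ℕₚ.m≤n⇒m<n∨m≡n 2+2j≤n))
    where
    1+2j<n : suc (j ℕ.+ j) ℕ.< n
    1+2j<n = subst (ℕ._≤ n) (cong suc (ℕₚ.+-suc j j)) 2+2j≤n
    middle : suc j ℕ.+ suc j ℕ.< n ⊎ suc j ℕ.+ suc j ≡ n → coeff f (suc j) ≤ coeff f i
    middle (inj₁ 2+2j<n) = low≤high (suc j) i j+i≡n 2+2j<n
    middle (inj₂ 2+2j≡n) = ≤-reflexive (cong (coeff f)
      (ℕₚ.+-cancelˡ-≡ (suc j) (suc j) i (trans 2+2j≡n (sym j+i≡n))))

  unimodal : Unimodal f
  -- The peak is the last entry of the alternating chain, ⌊(n + 1)/2⌋ = ⌈n/2⌉.
  unimodal = n , hasDegree , ⌈ n /2⌉ , ℕₚ.⌈n/2⌉≤n n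
    , (λ i i<r → rising i (ℕₚ.≰⇒> λ n≤2i → ℕₚ.<⇒≱ i<r
        (subst (⌈ n /2⌉ ℕ.≤_) (sym (ℕₚ.n≡⌈n+n/2⌉ i)) (ℕₚ.⌈n/2⌉-mono n≤2i))))
    , (λ i r≤i i<n →
        let j     = n ∸ suc i
            j+i≡n = trans (sym (ℕₚ.+-suc j i)) (ℕₚ.m∸n+n≡m i<n)
            j<i   = ℕₚ.+-cancelʳ-≤ i (suc j) i (subst (ℕ._≤ i ℕ.+ i) (sym j+i≡n) (n≤2i i r≤i))
        in falling j i j+i≡n (subst (suc j ℕ.+ suc j ℕ.≤_) j+i≡n (ℕₚ.+-monoʳ-≤ (suc j) j<i)))
    where
    n≤2i : ∀ i → ⌈ n /2⌉ ℕ.≤ i → n ℕ.≤ i ℕ.+ i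
    n≤2i i r≤i = subst (ℕ._≤ i ℕ.+ i) (ℕₚ.⌊n/2⌋+⌈n/2⌉≡n n)
      (ℕₚ.+-mono-≤ (ℕₚ.≤-trans (ℕₚ.⌊n/2⌋≤⌈n/2⌉ n) r≤i) r≤i)

-- The polynomials J_{2n}

clear-denominator : ∀ N .{{_ : ℕ.NonZero N}} → ∃[ F ] 0ℚ < F × (ℤ.+ 1 / N) * F ≡ 1ℚ
clear-denominator (suc n) = nat (suc n) , 0<nat n , 1/-nat n
  where
  0<nat : ∀ n → 0ℚ < nat (suc n)
  0<nat zero    = positive⁻¹ 1ℚ
  0<nat (suc n) = +-mono-< (positive⁻¹ 1ℚ) (0<nat n)

sign² : ∀ n → (- 1ℚ) ^ n * (- 1ℚ) ^ n ≡ 1ℚ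
sign² zero    = refl
sign² (suc n) = trans (lemma ((- 1ℚ) ^ n)) (sign² n)
  where
  lemma : ∀ s → - 1ℚ * s * (- 1ℚ * s) ≡ s * s
  lemma = solve-∀ ℚ-ring

-- Solves the equation of the Taylor coefficients cn = β - α for e, the value of J_{2n+2}. Here σ =
-- (-1)^n, r = 1/(2n+2)! and F = 1/r; the opposite signs of `α̂` and `b̂` turn the difference into a
-- sum.
combine : ∀ σ r F x {e b̂ α̂ ea eb} → σ * σ ≡ 1ℚ → r * F ≡ 1ℚ →
          F * b̂ ≡ - (σ * eb) → F * α̂ ≡ σ * ea → - 1ℚ * σ * e * r ≡ x * b̂ - α̂ →
          e ≡ ea + (0ℚ + x * eb)
combine σ r F x {e} {b̂} {α̂} {ea} {eb} σσ≡1 rF≡1 Fb̂≡ Fα̂≡ e≡ = begin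
  e                                       ≡⟨ *-identityʳ e ⟨
  e * 1ℚ                                  ≡⟨ cong₂ _*_ (trans (cong (_* e) σσ≡1) (*-identityˡ e)) rF≡1 ⟨
  σ * σ * e * (r * F)                     ≡⟨ lemma₁ σ e r F ⟩
  - σ * (F * (- 1ℚ * σ * e * r))          ≡⟨ cong (λ t → - σ * (F * t)) e≡ ⟩
  - σ * (F * (x * b̂ - α̂))                 ≡⟨ cong (- σ *_) (lemma₂ F x b̂ α̂) ⟩
  - σ * (x * (F * b̂) - F * α̂)             ≡⟨ cong₂ (λ u v → - σ * (x * u - v)) Fb̂≡ Fα̂≡ ⟩
  - σ * (x * - (σ * eb) - σ * ea)         ≡⟨ lemma₃ σ x ea eb ⟩
  σ * σ * (ea + (0ℚ + x * eb))            ≡⟨ cong (_* (ea + (0ℚ + x * eb))) σσ≡1 ⟩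
  1ℚ * (ea + (0ℚ + x * eb))               ≡⟨ *-identityˡ (ea + (0ℚ + x * eb)) ⟩
  ea + (0ℚ + x * eb)                      ∎
  where
  open ≡-Reasoning
  lemma₁ : ∀ σ e r F → σ * σ * e * (r * F) ≡ - σ * (F * (- 1ℚ * σ * e * r))
  lemma₁ = solve-∀ ℚ-ring
  lemma₂ : ∀ F x b a → F * (x * b - a) ≡ x * (F * b) - F * a
  lemma₂ = solve-∀ ℚ-ring
  lemma₃ : ∀ σ x a b → - σ * (x * - (σ * b) - σ * a) ≡ σ * σ * (a + (0ℚ + x * b))
  lemma₃ = solve-∀ ℚ-ring

module _ (J : ℕ → Poly) (isJ : IsJacobiCnPolynomials J) where

  private
    K : Set
    K = Σ[ k ∈ ℚ ] 0ℚ < k × k < 1ℚ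

    x : K → ℚ
    x (k , _) = k ^ 2

    c : K → Series
    c (k , 0<k , k<1) = proj₁ (proj₂ isJ k 0<k k<1)

    jacobi : ∀ κ → Σ[ α ∈ Series ] Σ[ β ∈ Series ] Σ[ s ∈ Series ] IsJacobiSystem (x κ) (c κ) α β s
    jacobi (k , 0<k , k<1) = jacobiSystem 0<k k<1 (proj₁ (proj₂ (proj₂ isJ k 0<k k<1)))

    α β s : K → Series
    α κ = proj₁ (jacobi κ)
    β κ = proj₁ (proj₂ (jacobi κ))
    s κ = proj₁ (proj₂ (proj₂ (jacobi κ)))

    system : ∀ κ → IsJacobiSystem (x κ) (c κ) (α κ) (β κ) (s κ)
    system κ = proj₂ (proj₂ (proj₂ (jacobi κ)))

  open JacobiCoefficients x c α β s system

  private
    -- Index 2n stands for degree n - 1, whence the additional sign. For n = 0 the function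
    -- vanishes, in accordance with J_2 = 1, where b = 0.
    γPoly⁻ : ∀ n {b} → Graded x (n ℕ.* 2) b →
             Σ[ p ∈ Poly ] IsγPoly⁻ n p × (∀ κ → b κ ≡ - ((- 1ℚ) ^ n * eval p (x κ)))
    γPoly⁻ zero (nil₀ z) = [] , refl , z
    γPoly⁻ (suc n) b-graded with graded⇒γPoly n b-graded
    ... | p , p-γ , b≡ = p , p-γ , λ κ → trans (b≡ κ) (lemma ((- 1ℚ) ^ n) (eval p (x κ)))
      where
      lemma : ∀ s a → s * a ≡ - (- 1ℚ * s * a)
      lemma = solve-∀ ℚ-ring

  module Decomposition (n : ℕ) where
    private
      1/N F : ℚ
      1/N = (ℤ.+ 1 / (2 ℕ.* suc n) !) {{(2 ℕ.* suc n) ℕₚ.!≢0}}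
      F   = proj₁ (clear-denominator ((2 ℕ.* suc n) !) {{(2 ℕ.* suc n) ℕₚ.!≢0}})

      0<F : 0ℚ < F
      0<F = proj₁ (proj₂ (clear-denominator ((2 ℕ.* suc n) !) {{(2 ℕ.* suc n) ℕₚ.!≢0}}))

      1/N*F≡1 : 1/N * F ≡ 1ℚ
      1/N*F≡1 = proj₂ (proj₂ (clear-denominator ((2 ℕ.* suc n) !) {{(2 ℕ.* suc n) ℕₚ.!≢0}}))

      b̂ : K → ℚ
      b̂ = proj₁ (β-graded (n ℕ.* 2))

      a-result : Σ[ p ∈ Poly ] IsγPoly n p × 0ℚ < coeff p 0 ×
        (∀ κ → F * α κ (2 ℕ.+ n ℕ.* 2) ≡ (- 1ℚ) ^ n * eval p (x κ))
      a-result = gradedPos⇒γPoly n (timesPos F 0<F (α-gradedPos n))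

      b-result : Σ[ p ∈ Poly ] IsγPoly⁻ n p × (∀ κ → F * b̂ κ ≡ - ((- 1ℚ) ^ n * eval p (x κ)))
      b-result = γPoly⁻ n (times F (ℚₚ.<⇒≤ 0<F) (proj₁ (proj₂ (β-graded (n ℕ.* 2)))))

    a b : Poly
    a = proj₁ a-result
    b = proj₁ b-result

    a-γ : IsγPoly n a
    a-γ = proj₁ (proj₂ a-result)

    0<a₀ : 0ℚ < coeff a 0
    0<a₀ = proj₁ (proj₂ (proj₂ a-result))

    b-γ : IsγPoly⁻ n b
    b-γ = proj₁ (proj₂ b-result)

    private
      coefficient : ∀ κ → - 1ℚ * (- 1ℚ) ^ n * eval (J (suc n)) (x κ) * 1/N ≡
                          x κ * b̂ κ - α κ (2 ℕ.+ n ℕ.* 2)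
      coefficient κ@(k , 0<k , k<1) = begin
        - 1ℚ * (- 1ℚ) ^ n * eval (J (suc n)) (x κ) * 1/N
          ≡⟨ proj₁ (proj₂ (proj₂ (proj₂ isJ k 0<k k<1))) (suc n) (s≤s z≤n) ⟨
        c κ (2 ℕ.* suc n)
          ≡⟨ cong (c κ) (ℕₚ.*-comm 2 (suc n)) ⟩
        c κ (2 ℕ.+ n ℕ.* 2)
          ≡⟨ IsJacobiSystem.c≈β-α (system κ) (2 ℕ.+ n ℕ.* 2) ⟩
        β κ (2 ℕ.+ n ℕ.* 2) - α κ (2 ℕ.+ n ℕ.* 2)
          ≡⟨ cong (_- α κ (2 ℕ.+ n ℕ.* 2)) (proj₂ (proj₂ (β-graded (n ℕ.* 2))) κ) ⟩
        x κ * b̂ κ - α κ (2 ℕ.+ n ℕ.* 2) ∎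
        where open ≡-Reasoning

      eval-J : ∀ κ → eval (J (suc n)) (x κ) ≡ eval (a +ᵖ (0ℚ ∷ b)) (x κ)
      eval-J κ = trans
        (combine ((- 1ℚ) ^ n) 1/N F (x κ) (sign² n) 1/N*F≡1
          (proj₂ (proj₂ b-result) κ) (proj₂ (proj₂ (proj₂ a-result)) κ) (coefficient κ))
        (sym (eval-+ᵖ a (0ℚ ∷ b) (x κ)))

    decomposition : coeff (J (suc n)) ≈ˢ coeff a +ˢ X *ˢ coeff b
    decomposition i = trans
      (eval-injective (J (suc n)) (a +ᵖ (0ℚ ∷ b)) (λ k 0<k k<1 → eval-J (k , 0<k , k<1)) i)
      (trans (coeff-+ᵖ a (0ℚ ∷ b) i) (cong (coeff a i +_) (coeff-0∷ b i)))

one-γ : IsγPoly 0 (1ℚ ∷ [])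
one-γ = record
  { palindromic = palindromic-≈ (palindromic-[1+X]^ 0) (≈ˢ-sym (coeff-[1+x]^ 0))
  ; nonnegative = (λ _ → 1ℚ)
      , (λ i → trans (coeff-[1+x]^ 0 i) (sym (trans (+-identityʳ _)
          (trans (*-identityˡ ((1ˢ *ˢ 1ˢ) i)) (*ˢ-identityˡ 1ˢ i)))))
      , λ _ → ℚₚ.<⇒≤ (positive⁻¹ 1ℚ)
  }

theorem6 : (J : ℕ → Poly) → IsJacobiCnPolynomials J →
    ∀ n → Bi-γ-Positive (J n) × AlternatinglyIncreasing (J n) × Unimodal (J n)
theorem6 J isJ zero = bi-γ-positive , alternatinglyIncreasing , unimodal
  where
  open Decomposed 0 (J 0) (1ℚ ∷ []) [] one-γ (positive⁻¹ 1ℚ) refl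
    (λ i → trans (proj₁ isJ i)
      (sym (trans (cong₂ _+_ (coeff-[1+x]^ 0 i) (S.zeroʳ X i)) (+-identityʳ (1ˢ i)))))
theorem6 J isJ (suc n) = bi-γ-positive , alternatinglyIncreasing , unimodal
  where
  open Decomposition J isJ n
  open Decomposed n (J (suc n)) a b a-γ 0<a₀ b-γ decomposition
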